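{- Let $\lambda$ be a partition of $n\geq 1$ other than $(1,\ldots,1)$. Then the dimension of the Specht polytope $P(\lambda)$ equals the dimension of the Specht module $V(\lambda)$.
   Context: A word of length $n$ is a sequence of $n$ letters; $S_n$ acts on words of length $n$ by permuting positions, $(\sigma w)_i=w_{\sigma^{ -1}(i)}$. A rearrangement of $w$ is an element of its $S_n$-orbit. Words $w_1,w_2$ of the same length $n$ have complementary rearrangements if the diagonal action of $S_n$ on $\{\text{rearrangements of }w_1\}\times\{\text{rearrangements of }w_2\}$ has exactly one free orbit (an orbit whose points have trivial stabilizer); they are complementary if moreover $(w_1,w_2)$ lies in that free orbit. A complementary pair $(w_1,w_2)$ corresponds to the partition $\lambda$ of $n$ if, for every $j\ge1$, the $j$-th most common letter of $w_1$ occurs $\lambda_j$ times in $w_1$ and the $j$-th most common letter of $w_2$ occurs $\lambda^*_j$ times in $w_2$, where $\lambda^*_j=\#\{k:\lambda_k\ge j\}$ is the conjugate partition. Such a pair exists for every $\lambda$. Young's character: $\mathrm{Y}_{w_1,w_2}(r_1,r_2)=\sum_\sigma \mathrm{sign}(\sigma)$, the sum over all $\sigma\in S_n$ with $\sigma w_1=r_1$ and $\sigma w_2=r_2$. The Specht matrix for $\lambda$ has rows indexed by rearrangements $r_1$ of $w_1$, columns indexed by rearrangements $r_2$ of $w_2$, and entries $\mathrm{Y}_{w_1,w_2}(r_1,r_2)$, where $(w_1,w_2)$ is a complementary pair corresponding to $\lambda$ (the matrix is determined up to relabelling and a global sign). The Specht module $V(\lambda)$ is the column span (over $\mathbb{C}$)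 of this matrix. The Specht polytope $P(\lambda)$ is the convex hull of the columns of this matrix in $\mathbb{R}^N$, where $N$ is the number of rearrangements of $w_1$. The dimension of a polytope is the dimension of its affine hull. -}

module Defs where

open import Algebra.Bundles using (CommutativeRing)
open import Algebra.Structures using (IsCommutativeRing)
open import Data.Fin.Base as Fin using (Fin)
import Data.Fin.Properties as Fin
open import Data.Fin.Permutation as Perm
  using (Permutation′; _⟨$⟩ʳ_; _⟨$⟩ˡ_)
open import Data.Integer.Base as ℤ using (ℤ)
open import Data.List.Base as List using (List; []; _∷_)
import Data.List.Membership.Propositional as ListMembership
open import Data.List.Relation.Unary.All using (All)
open import Data.List.Relation.Unary.Linked using (Linked)
open import Data.List.Relation.Unary.Unique.Propositional using (Unique)
open import Data.Maybe.Base using (nothing)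
open import Data.Nat.Base as ℕ using (ℕ; zero; suc)
import Data.Nat.ListAction as ListAction
import Data.Nat.Properties as ℕ
open import Data.Product.Base using (Σ-syntax; ∃-syntax; _×_; _,_; proj₁; proj₂)
open import Data.Rational.Base as ℚ using (ℚ; 0ℚ; 1ℚ)
import Data.Rational.Properties as ℚ
open import Data.Vec.Base as Vec using (Vec; lookup; tabulate)
import Data.Vec.Membership.Propositional as VecMembership
open import Data.Vec.Properties using (≡-dec)
open import Level using (Level; _⊔_; 0ℓ)
open import Relation.Binary.Definitions using (DecidableEquality)
open import Relation.Binary.PropositionalEquality
  using (_≡_; refl; sym; trans; cong; cong₂; subst)
open import Relation.Nullary.Decidable using (_×-dec_)
open import Relation.Unary using (Pred)
import Algebra.Properties.CommutativeMonoid.Sum as Sum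
import Tactic.RingSolver.Core.AlmostCommutativeRing as ACR
open import Tactic.RingSolver using (solve-∀)

private variable
  a c ℓ i p : Level

-- For Cauchy sequences x ∼ y says that x and y have the same limit;
-- x ∼ x says that x is a Cauchy sequence.  Real numbers are Cauchy
-- sequences of rationals up to ∼.
infix 4 _∼_
_∼_ : (ℕ → ℚ) → (ℕ → ℚ) → Set
x ∼ y = ∀ ε → 0ℚ ℚ.< ε →
  ∃[ N ] (∀ m n → N ℕ.≤ m → N ℕ.≤ n → ℚ.∣ x m ℚ.- y n ∣ ℚ.< ε)

record ℝ : Set where
  constructor mkℝ
  field
    seq    : ℕ → ℚ
    cauchy : seq ∼ seq
open ℝ public

infix 4 _≈ʳ_ _≤ʳ_

record _≈ʳ_ (x y : ℝ) : Set where
  constructor mk≈ʳ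
  field
    sameLimit : seq x ∼ seq y
open _≈ʳ_ public

_≤ʳ_ : ℝ → ℝ → Set
x ≤ʳ y = ∀ ε → 0ℚ ℚ.< ε →
  ∃[ N ] (∀ n → N ℕ.≤ n → seq x n ℚ.≤ seq y n ℚ.+ ε)

private
  module ℝ-Laws where
    open import Data.Rational.Base
    open import Data.Rational.Properties

    acr : ACR.AlmostCommutativeRing 0ℓ 0ℓ
    acr = ACR.fromCommutativeRing +-*-commutativeRing (λ _ → nothing)

    abstract
      split : ∀ ε → 0ℚ < ε → ∃[ δ ] (0ℚ < δ × δ + δ ≡ ε)
      split ε 0<ε = ½ * ε
        , subst (_< ½ * ε) (*-zeroʳ ½) (*-monoʳ-<-pos ½ 0<ε)
        , trans (sym (*-distribʳ-+ ε ½ ½)) (*-identityˡ ε)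

      ∼-sym : ∀ x y → x ∼ y → y ∼ x
      ∼-sym x y x∼y ε 0<ε with N , h ← x∼y ε 0<ε =
        N , λ m n N≤m N≤n →
          subst (_< ε) (trans (sym (∣-p∣≡∣p∣ (x n - y m))) (cong ∣_∣ (flip (x n) (y m)))) (h n m N≤n N≤m)
        where
        flip : ∀ p q → - (p + - q) ≡ q + - p
        flip = solve-∀ acr

      ∼-trans : ∀ x y z → x ∼ y → y ∼ z → x ∼ z
      ∼-trans x y z x∼y y∼z ε 0<ε
        with δ , 0<δ , δ+δ≡ε ← split ε 0<ε
        with M , f ← x∼y δ 0<δ | N , g ← y∼z δ 0<δ
        = K , λ m n K≤m K≤n → begin-strict
            ∣ x m - z n ∣                      ≡⟨ cong ∣_∣ (via (x m) (y K) (z n)) ⟩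
            ∣ (x m - y K) + (y K - z n) ∣      ≤⟨ ∣p+q∣≤∣p∣+∣q∣ (x m - y K) (y K - z n) ⟩
            ∣ x m - y K ∣ + ∣ y K - z n ∣      <⟨ +-mono-< (f m K (ℕ.≤-trans M≤K K≤m) M≤K)
                                                           (g K n N≤K (ℕ.≤-trans N≤K K≤n)) ⟩
            δ + δ                              ≡⟨ δ+δ≡ε ⟩
            ε                                  ∎
        where
        open ≤-Reasoning
        K : ℕ
        K = M ℕ.⊔ N
        M≤K : M ℕ.≤ K
        M≤K = ℕ.m≤m⊔n M N
        N≤K : N ℕ.≤ K
        N≤K = ℕ.m≤n⊔m M N
        via : ∀ p q r → p + - r ≡ (p + - q) + (q + - r)
        via p q r = begin-equality
          p + - r                  ≡⟨ cong (_+ - r) (+-identityʳ p) ⟨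
          (p + 0ℚ) + - r           ≡⟨ cong (λ t → (p + t) + - r) (+-inverseˡ q) ⟨
          (p + (- q + q)) + - r    ≡⟨ reassoc p (- q) q (- r) ⟩
          (p + - q) + (q + - r)    ∎
          where
          reassoc : ∀ p q r s → (p + (q + r)) + s ≡ (p + q) + (r + s)
          reassoc = solve-∀ acr

      pointwise : ∀ x y → x ∼ x → (∀ n → x n ≡ y n) → x ∼ y
      pointwise x y x∼x eq ε 0<ε with N , h ← x∼x ε 0<ε =
        N , λ m n N≤m N≤n → subst (λ t → ∣ x m - t ∣ < ε) (eq n) (h m n N≤m N≤n)

      const∼ : ∀ q → (λ _ → q) ∼ (λ _ → q)
      const∼ q ε 0<ε = 0 , λ _ _ _ _ → subst (λ t → ∣ t ∣ < ε) (sym (+-inverseʳ q)) 0<ε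

      +-cong∼ : ∀ x x′ y y′ → x ∼ x′ → y ∼ y′ →
                (λ n → x n + y n) ∼ (λ n → x′ n + y′ n)
      +-cong∼ x x′ y y′ x∼x′ y∼y′ ε 0<ε
        with δ , 0<δ , δ+δ≡ε ← split ε 0<ε
        with M , f ← x∼x′ δ 0<δ | N , g ← y∼y′ δ 0<δ
        = M ℕ.⊔ N , λ m n K≤m K≤n → begin-strict
            ∣ (x m + y m) - (x′ n + y′ n) ∣      ≡⟨ cong ∣_∣ (swap (x m) (y m) (x′ n) (y′ n)) ⟩
            ∣ (x m - x′ n) + (y m - y′ n) ∣      ≤⟨ ∣p+q∣≤∣p∣+∣q∣ (x m - x′ n) (y m - y′ n) ⟩
            ∣ x m - x′ n ∣ + ∣ y m - y′ n ∣      <⟨ +-mono-< (f m n (left K≤m) (left K≤n))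
                                                             (g m n (right K≤m) (right K≤n)) ⟩
            δ + δ                                ≡⟨ δ+δ≡ε ⟩
            ε                                    ∎
        where
        open ≤-Reasoning
        left : ∀ {k} → M ℕ.⊔ N ℕ.≤ k → M ℕ.≤ k
        left = ℕ.≤-trans (ℕ.m≤m⊔n M N)
        right : ∀ {k} → M ℕ.⊔ N ℕ.≤ k → N ℕ.≤ k
        right = ℕ.≤-trans (ℕ.m≤n⊔m M N)
        swap : ∀ p q r s → (p + q) + - (r + s) ≡ (p + - r) + (q + - s)
        swap = solve-∀ acr

      neg-cong∼ : ∀ x x′ → x ∼ x′ → (λ n → - x n) ∼ (λ n → - x′ n)
      neg-cong∼ x x′ x∼x′ ε 0<ε with N , h ← x∼x′ ε 0<ε =
        N , λ m n N≤m N≤n →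
          subst (_< ε) (trans (sym (∣-p∣≡∣p∣ (x m - x′ n))) (cong ∣_∣ (neg-diff (x m) (x′ n)))) (h m n N≤m N≤n)
        where
        neg-diff : ∀ p q → - (p + - q) ≡ - p + - (- q)
        neg-diff = solve-∀ acr

      bounded : ∀ x x′ → x ∼ x′ →
                ∃[ B ] (0ℚ < B × ∃[ N ] (∀ n → N ℕ.≤ n → ∣ x n ∣ < B))
      bounded x x′ x∼x′ with N , h ← x∼x′ 1ℚ (positive⁻¹ 1ℚ) =
        1ℚ + ∣ x′ N ∣ , +-mono-<-≤ (positive⁻¹ 1ℚ) (0≤∣p∣ (x′ N)) , N , λ n N≤n → begin-strict
          ∣ x n ∣                         ≡⟨ cong ∣_∣ (via (x n) (x′ N)) ⟩
          ∣ (x n - x′ N) + x′ N ∣         ≤⟨ ∣p+q∣≤∣p∣+∣q∣ (x n - x′ N) (x′ N) ⟩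
          ∣ x n - x′ N ∣ + ∣ x′ N ∣       <⟨ +-monoˡ-< ∣ x′ N ∣ (h n N N≤n ℕ.≤-refl) ⟩
          1ℚ + ∣ x′ N ∣                   ∎
        where
        open ≤-Reasoning
        via : ∀ p q → p ≡ (p + - q) + q
        via p q = sym (trans (+-assoc p (- q) q)
                        (trans (cong (p +_) (+-inverseˡ q)) (+-identityʳ p)))

      *-mono-bound : ∀ p q {B δ} → 0ℚ < B → ∣ p ∣ < B → ∣ q ∣ < δ → ∣ p * q ∣ < B * δ
      *-mono-bound p q {B} {δ} 0<B p<B q<δ = begin-strict
        ∣ p * q ∣        ≡⟨ ∣p*q∣≡∣p∣*∣q∣ p q ⟩
        ∣ p ∣ * ∣ q ∣    ≤⟨ *-monoʳ-≤-nonNeg ∣ q ∣ {{nonNegative (0≤∣p∣ q)}} (<⇒≤ p<B) ⟩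
        B * ∣ q ∣        <⟨ *-monoʳ-<-pos B {{positive 0<B}} q<δ ⟩
        B * δ            ∎
        where open ≤-Reasoning

      quotient : ∀ B ε → 0ℚ < B → 0ℚ < ε → ∃[ δ ] (0ℚ < δ × B * δ ≡ ε)
      quotient B ε 0<B 0<ε = 1/B * ε
        , subst (_< 1/B * ε) (*-zeroʳ 1/B) (*-monoʳ-<-pos 1/B {{1/pos⇒pos B {{positive 0<B}}}} 0<ε)
        , trans (sym (*-assoc B 1/B ε))
            (trans (cong (_* ε) (*-inverseʳ B {{B≢0}})) (*-identityˡ ε))
        where
        B≢0 : NonZero B
        B≢0 = pos⇒nonZero B {{positive 0<B}}
        1/B : ℚ
        1/B = (1/ B) {{B≢0}}

      *-split : ∀ p q r s → p * q + - (r * s) ≡ p * (q + - s) + s * (p + - r)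
      *-split p q r s = begin-equality
        p * q + - (r * s)                            ≡⟨ cong (_+ - (r * s)) (+-identityʳ (p * q)) ⟨
        (p * q + 0ℚ) + - (r * s)                     ≡⟨ cong (λ t → (p * q + t) + - (r * s)) (+-inverseˡ (p * s)) ⟨
        (p * q + (- (p * s) + p * s)) + - (r * s)    ≡⟨ regroup p q r s ⟩
        p * (q + - s) + s * (p + - r)                ∎
        where
        open ≤-Reasoning
        regroup : ∀ p q r s →
          (p * q + (- (p * s) + p * s)) + - (r * s) ≡ p * (q + - s) + s * (p + - r)
        regroup = solve-∀ acr

      *-close : ∀ p q r s {B C δ} → 0ℚ < B → 0ℚ < C → ∣ p ∣ < B → ∣ s ∣ < C →
                ∣ q - s ∣ < δ → ∣ p - r ∣ < δ → ∣ p * q - r * s ∣ < (B + C) * δ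
      *-close p q r s {B} {C} {δ} 0<B 0<C p<B s<C q-s<δ p-r<δ = begin-strict
        ∣ p * q - r * s ∣                      ≡⟨ cong ∣_∣ (*-split p q r s) ⟩
        ∣ p * (q - s) + s * (p - r) ∣          ≤⟨ ∣p+q∣≤∣p∣+∣q∣ (p * (q - s)) (s * (p - r)) ⟩
        ∣ p * (q - s) ∣ + ∣ s * (p - r) ∣      <⟨ +-mono-< (*-mono-bound p (q - s) 0<B p<B q-s<δ)
                                                           (*-mono-bound s (p - r) 0<C s<C p-r<δ) ⟩
        B * δ + C * δ                          ≡⟨ *-distribʳ-+ δ B C ⟨
        (B + C) * δ                            ∎
        where open ≤-Reasoning

      *-cong∼ : ∀ x x′ y y′ → x ∼ x′ → y ∼ y′ →
                (λ n → x n * y n) ∼ (λ n → x′ n * y′ n)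
      *-cong∼ x x′ y y′ x∼x′ y∼y′ ε 0<ε =
        let B , 0<B , M₁ , ∣x∣<B  = bounded x x′ x∼x′
            C , 0<C , M₂ , ∣y′∣<C = bounded y′ y (∼-sym y y′ y∼y′)
            δ , 0<δ , [B+C]δ≡ε    = quotient (B + C) ε (+-mono-< 0<B 0<C) 0<ε
            M , f                 = x∼x′ δ 0<δ
            N , g                 = y∼y′ δ 0<δ
        in (M₁ ℕ.⊔ M₂) ℕ.⊔ (M ℕ.⊔ N) , λ m n K≤m K≤n →
          let M₁⊔M₂≤m = ℕ.m⊔n≤o⇒m≤o (M₁ ℕ.⊔ M₂) (M ℕ.⊔ N) K≤m
              M₁⊔M₂≤n = ℕ.m⊔n≤o⇒m≤o (M₁ ℕ.⊔ M₂) (M ℕ.⊔ N) K≤n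
              M⊔N≤m   = ℕ.m⊔n≤o⇒n≤o (M₁ ℕ.⊔ M₂) (M ℕ.⊔ N) K≤m
              M⊔N≤n   = ℕ.m⊔n≤o⇒n≤o (M₁ ℕ.⊔ M₂) (M ℕ.⊔ N) K≤n
          in subst (∣ x m * y m - x′ n * y′ n ∣ <_) [B+C]δ≡ε
               (*-close (x m) (y m) (x′ n) (y′ n) 0<B 0<C
                 (∣x∣<B m (ℕ.m⊔n≤o⇒m≤o M₁ M₂ M₁⊔M₂≤m))
                 (∣y′∣<C n (ℕ.m⊔n≤o⇒n≤o M₁ M₂ M₁⊔M₂≤n))
                 (g m n (ℕ.m⊔n≤o⇒n≤o M N M⊔N≤m) (ℕ.m⊔n≤o⇒n≤o M N M⊔N≤n))
                 (f m n (ℕ.m⊔n≤o⇒m≤o M N M⊔N≤m) (ℕ.m⊔n≤o⇒m≤o M N M⊔N≤n)))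

ℚ→ℝ : ℚ → ℝ
ℚ→ℝ q = mkℝ (λ _ → q) (ℝ-Laws.const∼ q)

infixl 6 _+ʳ_
infixl 7 _*ʳ_
infix  8 -ʳ_

_+ʳ_ : ℝ → ℝ → ℝ
x +ʳ y = mkℝ (λ n → seq x n ℚ.+ seq y n) (ℝ-Laws.+-cong∼ (seq x) (seq x) (seq y) (seq y) (cauchy x) (cauchy y))

_*ʳ_ : ℝ → ℝ → ℝ
x *ʳ y = mkℝ (λ n → seq x n ℚ.* seq y n) (ℝ-Laws.*-cong∼ (seq x) (seq x) (seq y) (seq y) (cauchy x) (cauchy y))

-ʳ_ : ℝ → ℝ
-ʳ x = mkℝ (λ n → ℚ.- seq x n) (ℝ-Laws.neg-cong∼ (seq x) (seq x) (cauchy x))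

0ʳ 1ʳ : ℝ
0ʳ = ℚ→ℝ 0ℚ
1ʳ = ℚ→ℝ 1ℚ

private
  ≡⇒≈ʳ : ∀ x {y} → (∀ n → seq x n ≡ seq y n) → x ≈ʳ y
  ≡⇒≈ʳ x {y} eq = mk≈ʳ (ℝ-Laws.pointwise (seq x) (seq y) (cauchy x) eq)

  +ʳ-cong : ∀ {x x′ y y′} → x ≈ʳ x′ → y ≈ʳ y′ → x +ʳ y ≈ʳ x′ +ʳ y′
  +ʳ-cong {x} {x′} {y} {y′} (mk≈ʳ p) (mk≈ʳ q) =
    mk≈ʳ (ℝ-Laws.+-cong∼ (seq x) (seq x′) (seq y) (seq y′) p q)

  *ʳ-cong : ∀ {x x′ y y′} → x ≈ʳ x′ → y ≈ʳ y′ → x *ʳ y ≈ʳ x′ *ʳ y′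
  *ʳ-cong {x} {x′} {y} {y′} (mk≈ʳ p) (mk≈ʳ q) =
    mk≈ʳ (ℝ-Laws.*-cong∼ (seq x) (seq x′) (seq y) (seq y′) p q)

  -ʳ-cong : ∀ {x x′} → x ≈ʳ x′ → -ʳ x ≈ʳ -ʳ x′
  -ʳ-cong {x} {x′} (mk≈ʳ p) = mk≈ʳ (ℝ-Laws.neg-cong∼ (seq x) (seq x′) p)

  ≈ʳ-sym : ∀ {x y} → x ≈ʳ y → y ≈ʳ x
  ≈ʳ-sym {x} {y} (mk≈ʳ p) = mk≈ʳ (ℝ-Laws.∼-sym (seq x) (seq y) p)

  ≈ʳ-trans : ∀ {x y z} → x ≈ʳ y → y ≈ʳ z → x ≈ʳ z
  ≈ʳ-trans {x} {y} {z} (mk≈ʳ p) (mk≈ʳ q) =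
    mk≈ʳ (ℝ-Laws.∼-trans (seq x) (seq y) (seq z) p q)

ℝ-isCommutativeRing : IsCommutativeRing _≈ʳ_ _+ʳ_ _*ʳ_ -ʳ_ 0ʳ 1ʳ
ℝ-isCommutativeRing = record
  { isRing = record
    { +-isAbelianGroup = record
      { isGroup = record
        { isMonoid = record
          { isSemigroup = record
            { isMagma = record
              { isEquivalence = record
                { refl  = λ {x} → mk≈ʳ (cauchy x)
                ; sym   = ≈ʳ-sym
                ; trans = ≈ʳ-trans
                }
              ; ∙-cong = +ʳ-cong
              }
            ; assoc = λ x y z → ≡⇒≈ʳ ((x +ʳ y) +ʳ z)
                (λ n → ℚ.+-assoc (seq x n) (seq y n) (seq z n))
            }
          ; identity = (λ x → ≡⇒≈ʳ (0ʳ +ʳ x) (λ n → ℚ.+-identityˡ (seq x n)))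
                     , (λ x → ≡⇒≈ʳ (x +ʳ 0ʳ) (λ n → ℚ.+-identityʳ (seq x n)))
          }
        ; inverse = (λ x → ≡⇒≈ʳ (-ʳ x +ʳ x) (λ n → ℚ.+-inverseˡ (seq x n)))
                  , (λ x → ≡⇒≈ʳ (x +ʳ -ʳ x) (λ n → ℚ.+-inverseʳ (seq x n)))
        ; ⁻¹-cong = -ʳ-cong
        }
      ; comm = λ x y → ≡⇒≈ʳ (x +ʳ y) (λ n → ℚ.+-comm (seq x n) (seq y n))
      }
    ; *-cong = *ʳ-cong
    ; *-assoc = λ x y z → ≡⇒≈ʳ ((x *ʳ y) *ʳ z)
        (λ n → ℚ.*-assoc (seq x n) (seq y n) (seq z n))
    ; *-identity = (λ x → ≡⇒≈ʳ (1ʳ *ʳ x) (λ n → ℚ.*-identityˡ (seq x n)))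
                 , (λ x → ≡⇒≈ʳ (x *ʳ 1ʳ) (λ n → ℚ.*-identityʳ (seq x n)))
    ; distrib = (λ x y z → ≡⇒≈ʳ (x *ʳ (y +ʳ z))
                   (λ n → ℚ.*-distribˡ-+ (seq x n) (seq y n) (seq z n)))
              , (λ x y z → ≡⇒≈ʳ ((y +ʳ z) *ʳ x)
                   (λ n → ℚ.*-distribʳ-+ (seq x n) (seq y n) (seq z n)))
    }
  ; *-comm = λ x y → ≡⇒≈ʳ (x *ʳ y) (λ n → ℚ.*-comm (seq x n) (seq y n))
  }

ℝ-commutativeRing : CommutativeRing 0ℓ 0ℓ
ℝ-commutativeRing = record { isCommutativeRing = ℝ-isCommutativeRing }

module AdjoinI (R : CommutativeRing c ℓ) where
  open CommutativeRing R renaming (refl to ≈-refl; sym to ≈-sym; trans to ≈-trans)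
  open import Algebra.Properties.Ring ring using (-0#≈0#; -1*x≈-x)
  open import Algebra.Solver.Ring.NaturalCoefficients.Default commutativeSemiring
    using (solve; _:+_; _:*_; _:=_)

  infix  4 _≈ᶜ_
  infixl 6 _+ᶜ_
  infixl 7 _*ᶜ_
  infix  8 -ᶜ_

  _≈ᶜ_ : Carrier × Carrier → Carrier × Carrier → Set ℓ
  (x , y) ≈ᶜ (u , v) = x ≈ u × y ≈ v

  _+ᶜ_ _*ᶜ_ : Carrier × Carrier → Carrier × Carrier → Carrier × Carrier
  (x , y) +ᶜ (u , v) = x + u , y + v
  (x , y) *ᶜ (u , v) = x * u - y * v , x * v + y * u

  -ᶜ_ : Carrier × Carrier → Carrier × Carrier
  -ᶜ (x , y) = - x , - y

  private
    -- The semiring solver does not know negation, so differences p - q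
    -- are first rewritten to p + (- 1#) * q.
    sub : ∀ p q → p - q ≈ p + (- 1#) * q
    sub p q = +-congˡ (≈-sym (-1*x≈-x q))

    assoc-re : ∀ x y u v s t →
      (x * u - y * v) * s - (x * v + y * u) * t ≈ x * (u * s - v * t) - y * (u * t + v * s)
    assoc-re x y u v s t = ≈-trans (≈-trans (sub _ _) (+-congʳ (*-congʳ (sub _ _))))
      (≈-trans (lemma (- 1#) x y u v s t)
        (≈-sym (≈-trans (sub _ _) (+-congʳ (*-congˡ (sub _ _))))))
      where
      lemma : ∀ j x y u v s t →
        (x * u + j * (y * v)) * s + j * ((x * v + y * u) * t)
          ≈ x * (u * s + j * (v * t)) + j * (y * (u * t + v * s))
      lemma = solve 7 (λ j x y u v s t →
        (x :* u :+ j :* (y :* v)) :* s :+ j :* ((x :* v :+ y :* u) :* t)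
          := x :* (u :* s :+ j :* (v :* t)) :+ j :* (y :* (u :* t :+ v :* s))) ≈-refl

    assoc-im : ∀ x y u v s t →
      (x * u - y * v) * t + (x * v + y * u) * s ≈ x * (u * t + v * s) + y * (u * s - v * t)
    assoc-im x y u v s t = ≈-trans (+-congʳ (*-congʳ (sub _ _)))
      (≈-trans (lemma (- 1#) x y u v s t) (≈-sym (+-congˡ (*-congˡ (sub _ _)))))
      where
      lemma : ∀ j x y u v s t →
        (x * u + j * (y * v)) * t + (x * v + y * u) * s
          ≈ x * (u * t + v * s) + y * (u * s + j * (v * t))
      lemma = solve 7 (λ j x y u v s t →
        (x :* u :+ j :* (y :* v)) :* t :+ (x :* v :+ y :* u) :* s
          := x :* (u :* t :+ v :* s) :+ y :* (u :* s :+ j :* (v :* t))) ≈-refl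

    distrib-re : ∀ x y u v s t →
      x * (u + s) - y * (v + t) ≈ (x * u - y * v) + (x * s - y * t)
    distrib-re x y u v s t = ≈-trans (sub _ _)
      (≈-trans (lemma (- 1#) x y u v s t) (≈-sym (+-cong (sub _ _) (sub _ _))))
      where
      lemma : ∀ j x y u v s t →
        x * (u + s) + j * (y * (v + t)) ≈ (x * u + j * (y * v)) + (x * s + j * (y * t))
      lemma = solve 7 (λ j x y u v s t →
        x :* (u :+ s) :+ j :* (y :* (v :+ t))
          := (x :* u :+ j :* (y :* v)) :+ (x :* s :+ j :* (y :* t))) ≈-refl

    distrib-im : ∀ x y u v s t →
      x * (v + t) + y * (u + s) ≈ (x * v + y * u) + (x * t + y * s)
    distrib-im = solve 6 (λ x y u v s t →
      x :* (v :+ t) :+ y :* (u :+ s)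
        := (x :* v :+ y :* u) :+ (x :* t :+ y :* s)) ≈-refl

    comm-re : ∀ x y u v → x * u - y * v ≈ u * x - v * y
    comm-re x y u v = +-cong (*-comm x u) (-‿cong (*-comm y v))

    comm-im : ∀ x y u v → x * v + y * u ≈ u * y + v * x
    comm-im x y u v = ≈-trans (+-comm _ _) (+-cong (*-comm y u) (*-comm x v))

    identity-re : ∀ x y → 1# * x - 0# * y ≈ x
    identity-re x y = ≈-trans
      (+-cong (*-identityˡ x) (≈-trans (-‿cong (zeroˡ y)) -0#≈0#)) (+-identityʳ x)

    identity-im : ∀ x y → 1# * y + 0# * x ≈ y
    identity-im x y = ≈-trans (+-cong (*-identityˡ y) (zeroˡ x)) (+-identityʳ y)

    ≈ᶜ-trans : ∀ {z w v} → z ≈ᶜ w → w ≈ᶜ v → z ≈ᶜ v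
    ≈ᶜ-trans (p , q) (r , s) = ≈-trans p r , ≈-trans q s

    *ᶜ-comm : ∀ z w → z *ᶜ w ≈ᶜ w *ᶜ z
    *ᶜ-comm (x , y) (u , v) = comm-re x y u v , comm-im x y u v

    *ᶜ-identityˡ : ∀ z → (1# , 0#) *ᶜ z ≈ᶜ z
    *ᶜ-identityˡ (x , y) = identity-re x y , identity-im x y

    *ᶜ-distribˡ : ∀ z w v → z *ᶜ (w +ᶜ v) ≈ᶜ z *ᶜ w +ᶜ z *ᶜ v
    *ᶜ-distribˡ (x , y) (u , v) (s , t) = distrib-re x y u v s t , distrib-im x y u v s t

    +ᶜ-cong : ∀ {z z′ w w′} → z ≈ᶜ z′ → w ≈ᶜ w′ → z +ᶜ w ≈ᶜ z′ +ᶜ w′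
    +ᶜ-cong (p , q) (r , s) = +-cong p r , +-cong q s

  adjoinI-isCommutativeRing : IsCommutativeRing _≈ᶜ_ _+ᶜ_ _*ᶜ_ -ᶜ_ (0# , 0#) (1# , 0#)
  adjoinI-isCommutativeRing = record
    { isRing = record
      { +-isAbelianGroup = record
        { isGroup = record
          { isMonoid = record
            { isSemigroup = record
              { isMagma = record
                { isEquivalence = record
                  { refl  = ≈-refl , ≈-refl
                  ; sym   = λ (p , q) → ≈-sym p , ≈-sym q
                  ; trans = ≈ᶜ-trans
                  }
                ; ∙-cong = +ᶜ-cong
                }
              ; assoc = λ (x , y) (u , v) (s , t) → +-assoc x u s , +-assoc y v t
              }
            ; identity = (λ (x , y) → +-identityˡ x , +-identityˡ y)
                       , (λ (x , y) → +-identityʳ x , +-identityʳ y)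
            }
          ; inverse = (λ (x , y) → -‿inverseˡ x , -‿inverseˡ y)
                    , (λ (x , y) → -‿inverseʳ x , -‿inverseʳ y)
          ; ⁻¹-cong = λ (p , q) → -‿cong p , -‿cong q
          }
        ; comm = λ (x , y) (u , v) → +-comm x u , +-comm y v
        }
      ; *-cong = λ (p , q) (r , s) →
          +-cong (*-cong p r) (-‿cong (*-cong q s)) , +-cong (*-cong p s) (*-cong q r)
      ; *-assoc = λ (x , y) (u , v) (s , t) →
          assoc-re x y u v s t , assoc-im x y u v s t
      ; *-identity = *ᶜ-identityˡ , (λ z → ≈ᶜ-trans (*ᶜ-comm z _) (*ᶜ-identityˡ z))
      ; distrib = *ᶜ-distribˡ , λ z w v →
          ≈ᶜ-trans (*ᶜ-comm (w +ᶜ v) z)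
            (≈ᶜ-trans (*ᶜ-distribˡ z w v) (+ᶜ-cong (*ᶜ-comm z w) (*ᶜ-comm z v)))
      }
    ; *-comm = *ᶜ-comm
    }

  adjoinI : CommutativeRing c ℓ
  adjoinI = record { isCommutativeRing = adjoinI-isCommutativeRing }

ℂ-commutativeRing : CommutativeRing 0ℓ 0ℓ
ℂ-commutativeRing = AdjoinI.adjoinI ℝ-commutativeRing

ℂ : Set
ℂ = CommutativeRing.Carrier ℂ-commutativeRing

ℤ→ℝ : ℤ → ℝ
ℤ→ℝ z = ℚ→ℝ (z ℚ./ 1)

ℤ→ℂ : ℤ → ℂ
ℤ→ℂ z = ℤ→ℝ z , 0ʳ

module CoordinateSpace (K : CommutativeRing c ℓ) (I : Set i) where
  open CommutativeRing K using (Carrier; _≈_; _+_; _*_; 0#; 1#; +-commutativeMonoid)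
  open Sum +-commutativeMonoid using (sum)

  V : Set (c ⊔ i)
  V = I → Carrier

  infix 4 _≈ᵥ_
  _≈ᵥ_ : V → V → Set (ℓ ⊔ i)
  v ≈ᵥ w = ∀ x → v x ≈ w x

  infixl 6 _+ᵥ_
  _+ᵥ_ : V → V → V
  (v +ᵥ w) x = v x + w x

  0ᵥ : V
  0ᵥ _ = 0#

  combination : ∀ {k} → (Fin k → Carrier) → (Fin k → V) → V
  combination α vs x = sum (λ j → α j * vs j x)

  Span : Pred V p → Pred V (c ⊔ ℓ ⊔ i ⊔ p)
  Span S v = ∃[ k ] Σ[ vs ∈ (Fin k → V) ] Σ[ α ∈ (Fin k → Carrier) ]
    ((∀ j → S (vs j)) × v ≈ᵥ combination α vs)

  AffineHull : Pred V p → Pred V (c ⊔ ℓ ⊔ i ⊔ p)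
  AffineHull S v = ∃[ k ] Σ[ vs ∈ (Fin k → V) ] Σ[ α ∈ (Fin k → Carrier) ]
    ((∀ j → S (vs j)) × sum α ≈ 1# × v ≈ᵥ combination α vs)

  LinearlyIndependent : ∀ {k} → (Fin k → V) → Set (c ⊔ ℓ ⊔ i)
  LinearlyIndependent vs = ∀ α → combination α vs ≈ᵥ 0ᵥ → ∀ j → α j ≈ 0#

  -- For a linear subspace S: S has a basis of d vectors.
  HasDimension : Pred V p → ℕ → Set (c ⊔ ℓ ⊔ i ⊔ p)
  HasDimension S d = Σ[ b ∈ (Fin d → V) ]
    ( (∀ j → S (b j))
    × LinearlyIndependent b
    × (∀ v → S v → ∃[ α ] v ≈ᵥ combination α b))

  -- For an affine subspace A: for a point o of A, the linear subspace
  -- A - o has dimension d.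
  HasAffineDimension : Pred V p → ℕ → Set (c ⊔ ℓ ⊔ i ⊔ p)
  HasAffineDimension A d = ∃[ o ] (A o × HasDimension (λ v → A (o +ᵥ v)) d)

module RealSpace (I : Set i) where
  open CoordinateSpace ℝ-commutativeRing I public
  open Sum (CommutativeRing.+-commutativeMonoid ℝ-commutativeRing) using (sum)

  ConvexHull : Pred V p → Pred V (i ⊔ p)
  ConvexHull S v = ∃[ k ] Σ[ vs ∈ (Fin k → V) ] Σ[ α ∈ (Fin k → ℝ) ]
    ( (∀ j → S (vs j))
    × (∀ j → 0ʳ ≤ʳ α j)
    × sum α ≈ʳ 1ʳ
    × v ≈ᵥ combination α vs)

  HasPolytopeDimension : Pred V p → ℕ → Set (i ⊔ p)
  HasPolytopeDimension P = HasAffineDimension (AffineHull P)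

module ComplexSpace {i} (I : Set i) = CoordinateSpace ℂ-commutativeRing I

-- Each permutation of Fin (suc n) arises exactly once, by choosing the
-- image j of zero and a bijection between the remaining positions.
permutations : ∀ n → List (Permutation′ n)
permutations zero    = Perm.id ∷ []
permutations (suc n) =
  List.cartesianProductWith (Perm.insert Fin.zero) (List.allFin (suc n)) (permutations n)

inversions : ∀ {n} → Permutation′ n → ℕ
inversions {n} σ = List.length
  (List.filter (λ (j , k) → (j Fin.<? k) ×-dec ((σ ⟨$⟩ʳ k) Fin.<? (σ ⟨$⟩ʳ j)))
    (List.cartesianProduct (List.allFin n) (List.allFin n)))

sign : ∀ {n} → Permutation′ n → ℤ
sign σ = ℤ.-1ℤ ℤ.^ inversions σ

Word : Set a → ℕ → Set a
Word = Vec

module _ {A : Set a} {n : ℕ} where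

  -- (σ w)ᵢ = w_{σ⁻¹(i)}
  infixr 8 _•_
  _•_ : Permutation′ n → Word A n → Word A n
  σ • w = tabulate (λ j → lookup w (σ ⟨$⟩ˡ j))

  -- The membership proof is irrelevant, so that rearrangements are
  -- equal as soon as they are equal as words.
  record Rearrangement (w : Word A n) : Set a where
    constructor rearrangement
    field
      word    : Word A n
      .inOrbit : ∃[ σ ] σ • w ≡ word
  open Rearrangement public

  SameOrbit : Word A n × Word A n → Word A n × Word A n → Set a
  SameOrbit (r₁ , r₂) (s₁ , s₂) = ∃[ σ ] (σ • r₁ ≡ s₁ × σ • r₂ ≡ s₂)

  TrivialStabilizer : Word A n × Word A n → Set a
  TrivialStabilizer (r₁ , r₂) = ∀ σ → σ • r₁ ≡ r₁ → σ • r₂ ≡ r₂ → σ Perm.≈ Perm.id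

  OrbitIsFree : Word A n × Word A n → Set a
  OrbitIsFree r = ∀ s → SameOrbit r s → TrivialStabilizer s

  words : ∀ {w₁ w₂} → Rearrangement w₁ × Rearrangement w₂ → Word A n × Word A n
  words (r₁ , r₂) = word r₁ , word r₂

  HaveComplementaryRearrangements : Word A n → Word A n → Set a
  HaveComplementaryRearrangements w₁ w₂ =
    Σ[ r ∈ Rearrangement w₁ × Rearrangement w₂ ]
      ( OrbitIsFree (words r)
      × (∀ (s : Rearrangement w₁ × Rearrangement w₂) →
           OrbitIsFree (words s) → SameOrbit (words r) (words s)))

  Complementary : Word A n → Word A n → Set a
  Complementary w₁ w₂ =
    Σ[ (r , _) ∈ HaveComplementaryRearrangements w₁ w₂ ] SameOrbit (words r) (w₁ , w₂)

record Partition (n : ℕ) : Set where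
  field
    parts      : List ℕ
    decreasing : Linked ℕ._≥_ parts
    positive   : All (1 ℕ.≤_) parts
    total      : ListAction.sum parts ≡ n
open Partition public

-- The nonzero values of #{k : λ_k ≥ j} are those with 1 ≤ j ≤ max_k λ_k.
conjugateParts : List ℕ → List ℕ
conjugateParts ps =
  List.applyUpTo (λ j → List.length (List.filter (suc j ℕ.≤?_) ps)) (List.foldr ℕ._⊔_ 0 ps)

module _ {A : Set a} (_≟_ : DecidableEquality A) {n : ℕ} where
  open ListMembership using (_∈_)
  open VecMembership using () renaming (_∈_ to _occursIn_)

  occurrences : Word A n → A → ℕ
  occurrences w x = Vec.count (x ≟_) w

  -- The letters of w, from most to least common.
  record Ranking (w : Word A n) : Set a where
    field
      letters  : List A
      distinct : Unique letters
      sound    : ∀ {x} → x ∈ letters → x occursIn w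
      complete : ∀ {x} → x occursIn w → x ∈ letters
      ordered  : Linked (λ x y → occurrences w x ℕ.≥ occurrences w y) letters
  open Ranking public

  HasMultiplicities : Word A n → List ℕ → Set a
  HasMultiplicities w μ = Σ[ ρ ∈ Ranking w ] List.map (occurrences w) (letters ρ) ≡ μ

  CorrespondsTo : Word A n → Word A n → Partition n → Set a
  CorrespondsTo w₁ w₂ Λ =
    HasMultiplicities w₁ (parts Λ) × HasMultiplicities w₂ (conjugateParts (parts Λ))

  youngCharacter : (w₁ w₂ r₁ r₂ : Word A n) → ℤ
  youngCharacter w₁ w₂ r₁ r₂ = List.foldr ℤ._+_ ℤ.0ℤ (List.map sign
    (List.filter (λ σ → ≡-dec _≟_ (σ • w₁) r₁ ×-dec ≡-dec _≟_ (σ • w₂) r₂) (permutations n)))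

  spechtMatrix : (w₁ w₂ : Word A n) → Rearrangement w₁ → Rearrangement w₂ → ℤ
  spechtMatrix w₁ w₂ r₁ r₂ = youngCharacter w₁ w₂ (word r₁) (word r₂)

  SpechtModule : (w₁ w₂ : Word A n) → Pred (Rearrangement w₁ → ℂ) a
  SpechtModule w₁ w₂ = Span (λ v → ∃[ r₂ ] v ≈ᵥ (λ r₁ → ℤ→ℂ (spechtMatrix w₁ w₂ r₁ r₂)))
    where open ComplexSpace (Rearrangement w₁)

  SpechtPolytope : (w₁ w₂ : Word A n) → Pred (Rearrangement w₁ → ℝ) a
  SpechtPolytope w₁ w₂ =
    ConvexHull (λ v → ∃[ r₂ ] v ≈ᵥ (λ r₁ → ℤ→ℝ (spechtMatrix w₁ w₂ r₁ r₂)))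
    where open RealSpace (Rearrangement w₁)

  HasSpechtModuleDimension : (w₁ w₂ : Word A n) → ℕ → Set a
  HasSpechtModuleDimension w₁ w₂ =
    ComplexSpace.HasDimension (Rearrangement w₁) (SpechtModule w₁ w₂)

  HasSpechtPolytopeDimension : (w₁ w₂ : Word A n) → ℕ → Set a
  HasSpechtPolytopeDimension w₁ w₂ =
    RealSpace.HasPolytopeDimension (Rearrangement w₁) (SpechtPolytope w₁ w₂)

{-# OPTIONS --safe #-}

-- Since λ ≠ (1,…,1), some letter of w₁ is repeated.  The sum of all columns of the
-- Specht matrix has r₁-entry Σ sign σ over the σ with σ w₁ = r₁; this is the determinant of
-- the 0/1 matrix recording where letters of w₁ and r₁ agree, which vanishes because a letter
-- of r₁ is repeated.  So the barycentre of the columns is 0, and the affine hull of the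
-- polytope is the real span of the columns.  Gauss–Jordan elimination over ℚ gives a basis
-- of the column space with pivot rows; the pivots keep it a basis over ℝ and over ℂ,
-- so both dimensions equal the rank over ℚ.
module Submission where

open import Defs
open import Algebra.Bundles using (CommutativeRing; Monoid; Semiring)
import Algebra.Morphism.Construct.Composition as Composition
open import Algebra.Morphism.Structures using (IsMonoidHomomorphism; IsSemiringHomomorphism)
import Algebra.Properties.CommutativeSemigroup as CommutativeSemigroupProperties
import Algebra.Properties.Monoid.Sum as MonoidSum
import Algebra.Properties.Ring as RingProperties
import Algebra.Properties.Semiring.Sum as SemiringSum
open import Data.Bool.Base using (if_then_else_)
open import Data.Empty using (⊥-elim)
open import Data.Fin.Base as Fin using (Fin; zero; suc; inject₁; punchIn; toℕ)
open import Data.Fin.Permutation as Perm using (Permutation′; _⟨$⟩ʳ_; _⟨$⟩ˡ_)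
import Data.Fin.Properties as Fin
open import Data.Integer.Base as ℤ using (ℤ; 0ℤ; 1ℤ; -1ℤ)
import Data.Integer.Properties as ℤ
open import Data.List.Base as List using (List; []; _∷_; replicate)
import Data.List.Membership.DecPropositional as DecMembership
open import Data.List.Membership.Propositional using (_∈_)
open import Data.List.Membership.Propositional.Properties
  using (∈-map⁺; ∈-map⁻; ∈-lookup; ∈-allFin; ∈-deduplicate⁺; ∈-deduplicate⁻; ∈-cartesianProductWith⁺)
open import Data.List.Relation.Unary.All as All using (All; []; _∷_)
open import Data.List.Relation.Unary.All.Properties using (¬Any⇒All¬)
open import Data.List.Relation.Unary.AllPairs using (_∷_)
open import Data.List.Relation.Unary.Any as Any using (Any; here; there; any?)
open import Data.List.Relation.Unary.Any.Properties using (map⁻; lookup-index)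
open import Data.List.Relation.Unary.Unique.DecPropositional.Properties using (deduplicate-!)
open import Data.List.Relation.Unary.Unique.Propositional using (Unique)
open import Data.Nat.Base as ℕ using (ℕ; zero; suc; _≤_)
import Data.Nat.ListAction as ListAction
import Data.Nat.Properties as ℕ
open import Data.Product.Base using (∃₂; ∃-syntax; _×_; _,_; proj₁; proj₂)
open import Data.Rational.Base as ℚ using (ℚ; 0ℚ; 1ℚ)
import Data.Rational.Properties as ℚ
open import Data.Rational.Unnormalised.Base as ℚᵘ using (mkℚᵘ; *≡*)
import Data.Rational.Unnormalised.Properties as ℚᵘ
open import Data.Sum.Base using (_⊎_; inj₁; inj₂)
open import Data.Vec.Base as Vec using (Vec; []; _∷_; lookup)
open import Data.Vec.Functional using () renaming ([] to []ᶠ; _∷_ to _∷ᶠ_)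
import Data.Vec.Properties as Vec
open import Function.Base using (_∘_; id)
open import Function.Bundles using (Injection)
open import Function.Properties.Inverse using (↔⇒↣)
open import Level using (Level; _⊔_)
open import Relation.Binary.Bundles using (Setoid)
open import Relation.Binary.Definitions using (DecidableEquality; tri<; tri≈; tri>)
open import Relation.Binary.PropositionalEquality
  using (_≡_; _≢_; _≗_; refl; sym; trans; cong; cong₂; subst; module ≡-Reasoning)
import Relation.Binary.Reasoning.Setoid as SetoidReasoning
open import Relation.Nullary.Decidable using (Dec; yes; no; does; _×-dec_; recompute)
open import Relation.Nullary.Negation using (¬_)
open import Relation.Unary using (Pred; Decidable)

-- Equality of Cauchy reals cannot be decided constructively, so no pivot search can run over `ℝ` or
-- `ℂ`, while a dimension has to be witnessed by an explicit basis. This forces the detour through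
-- `ℚ`. The outcome of elimination is recorded purely as equations between sums, products, 0 and 1,
-- which every semiring homomorphism respects. The vanishing determinant is handled without
-- multiplicativity of `sign`. Since `sign` counts inversions and `permutations` is built by
-- choosing the image of the first position, the signed sum is matched with its Laplace expansion,
-- and that expansion is shown to change sign under adjacent swaps.

private variable
  a b c c′ ℓ ℓ′ i p q : Level
  A B C : Set a

module SumHomomorphism (M : Monoid c ℓ) (N : Monoid c′ ℓ′)
  {φ : Monoid.Carrier M → Monoid.Carrier N}
  (φ-hom : IsMonoidHomomorphism (Monoid.rawMonoid M) (Monoid.rawMonoid N) φ) where
  private
    module M = Monoid M
    module N = Monoid N
  open IsMonoidHomomorphism φ-hom
  open MonoidSum M using () renaming (sum to sumᴹ)
  open MonoidSum N using () renaming (sum to sumᴺ)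

  sum-homo : ∀ {n} (t : Fin n → M.Carrier) → φ (sumᴹ t) N.≈ sumᴺ (φ ∘ t)
  sum-homo {zero}  t = ε-homo
  sum-homo {suc n} t = N.trans (homo _ _) (N.∙-congˡ (sum-homo (t ∘ suc)))

-- Linear algebra over a commutative ring

module Elimination (K : CommutativeRing c ℓ) (I : Set i) where
  open CommutativeRing K hiding (zero) renaming (refl to ≈-refl; sym to ≈-sym; trans to ≈-trans)
  open CoordinateSpace K I
  open SemiringSum semiring
    using (sum; sum-cong-≋; sum-remove; sum-replicate-zero; ∑-comm; ∑-distrib-+; *-distribˡ-sum; *-distribʳ-sum)
  open SetoidReasoning setoid

  infix 4 _∈⟨_⟩
  -- In `Span` each vector brings its own list of generators. Fixing one finite family reduces
  -- membership to a coefficient vector.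
  _∈⟨_⟩ : ∀ {m} → V → (Fin m → V) → Set _
  v ∈⟨ vs ⟩ = ∃[ α ] v ≈ᵥ combination α vs

  sum-zero : ∀ {n} (t : Fin n → Carrier) → (∀ k → t k ≈ 0#) → sum t ≈ 0#
  sum-zero {n} t t≈0 = ≈-trans (sum-cong-≋ t≈0) (sum-replicate-zero n)

  sum-single : ∀ {n} (t : Fin n → Carrier) j → (∀ k → k ≢ j → t k ≈ 0#) → sum t ≈ t j
  sum-single {suc n} t j t≈0 = begin
    sum t                            ≈⟨ sum-remove {i = j} t ⟩
    t j + sum (λ k → t (punchIn j k)) ≈⟨ +-congˡ (sum-zero _ (λ k → t≈0 _ (Fin.punchInᵢ≢i j k))) ⟩
    t j + 0#                         ≈⟨ +-identityʳ (t j) ⟩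
    t j                              ∎

  -- Associativity of the matrix product of `α`, `β` and `vs`, by exchanging the two sums.
  combination-assoc : ∀ {l m} (us : Fin l → V) (vs : Fin m → V) (β : Fin l → Fin m → Carrier) →
    (∀ j → us j ≈ᵥ combination (β j) vs) → ∀ α →
    combination α us ≈ᵥ combination (λ k → sum (λ j → α j * β j k)) vs
  combination-assoc us vs β us≈ α x = begin
    sum (λ j → α j * us j x)                          ≈⟨ sum-cong-≋ (λ j → *-congˡ (us≈ j x)) ⟩
    sum (λ j → α j * sum (λ k → β j k * vs k x))      ≈⟨ sum-cong-≋ (λ j → *-distribˡ-sum (α j) (λ k → β j k * vs k x)) ⟩
    sum (λ j → sum (λ k → α j * (β j k * vs k x)))    ≈⟨ sum-cong-≋ (λ j → sum-cong-≋ (λ k → *-assoc (α j) (β j k) (vs k x))) ⟨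
    sum (λ j → sum (λ k → α j * β j k * vs k x))      ≈⟨ ∑-comm (λ j k → α j * β j k * vs k x) ⟩
    sum (λ k → sum (λ j → α j * β j k * vs k x))      ≈⟨ sum-cong-≋ (λ k → *-distribʳ-sum (vs k x) (λ j → α j * β j k)) ⟨
    sum (λ k → sum (λ j → α j * β j k) * vs k x)      ∎

  ∈⟨⟩-trans : ∀ {l m v} (us : Fin l → V) (vs : Fin m → V) →
    v ∈⟨ us ⟩ → (∀ j → us j ∈⟨ vs ⟩) → v ∈⟨ vs ⟩
  ∈⟨⟩-trans us vs (α , v≈) us∈ =
    _ , λ x → ≈-trans (v≈ x) (combination-assoc us vs (proj₁ ∘ us∈) (proj₂ ∘ us∈) α x)

  indicator : ∀ {n} → Fin n → Fin n → Carrier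
  indicator j k with j Fin.≟ k
  ... | yes _ = 1#
  ... | no _  = 0#

  indicator-diagonal : ∀ {n} (j : Fin n) → indicator j j ≈ 1#
  indicator-diagonal j with j Fin.≟ j
  ... | yes _  = ≈-refl
  ... | no j≢j = ⊥-elim (j≢j refl)

  indicator-off-diagonal : ∀ {n} {j k : Fin n} → k ≢ j → indicator j k ≈ 0#
  indicator-off-diagonal {j = j} {k} k≢j with j Fin.≟ k
  ... | yes refl = ⊥-elim (k≢j refl)
  ... | no _     = ≈-refl

  combination-indicator : ∀ {m} (vs : Fin m → V) j → combination (indicator j) vs ≈ᵥ vs j
  combination-indicator vs j x = begin
    sum (λ k → indicator j k * vs k x) ≈⟨ sum-single _ j (λ k k≢j → ≈-trans (*-congʳ (indicator-off-diagonal k≢j)) (zeroˡ _)) ⟩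
    indicator j j * vs j x             ≈⟨ *-congʳ (indicator-diagonal j) ⟩
    1# * vs j x                        ≈⟨ *-identityˡ _ ⟩
    vs j x                             ∎

  generator∈ : ∀ {m} (vs : Fin m → V) j → vs j ∈⟨ vs ⟩
  generator∈ vs j = indicator j , λ x → ≈-sym (combination-indicator vs j x)

  -- A common summand in all coefficients is invisible when the vectors sum to zero.
  affine-coefficients : ∀ {m v} (vs : Fin m → V) →
    (∀ x → sum (λ j → vs j x) ≈ 0#) → ∀ c → sum {m} (λ _ → 1#) * c ≈ 1# →
    v ∈⟨ vs ⟩ → ∃[ β ] (sum β ≈ 1# × v ≈ᵥ combination β vs)
  affine-coefficients {m} {v} vs vs≈0 c mc≈1 (α , v≈) = β , β-sum , λ x → begin
      v x                                                  ≈⟨ v≈ x ⟩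
      combination α vs x                                   ≈⟨ +-identityʳ _ ⟨
      combination α vs x + 0#                              ≈⟨ +-congˡ (zeroʳ t) ⟨
      combination α vs x + t * 0#                          ≈⟨ +-congˡ (*-congˡ (vs≈0 x)) ⟨
      combination α vs x + t * sum (λ j → vs j x)          ≈⟨ +-congˡ (*-distribˡ-sum t (λ j → vs j x)) ⟩
      combination α vs x + sum (λ j → t * vs j x)          ≈⟨ ∑-distrib-+ (λ j → α j * vs j x) (λ j → t * vs j x) ⟨
      sum (λ j → α j * vs j x + t * vs j x)                ≈⟨ sum-cong-≋ (λ j → distribʳ (vs j x) (α j) t) ⟨
      combination β vs x                                   ∎
    where
    -- `c` is the inverse of the number of vectors, so `t` spreads the missing amount `1 - sum α`
    -- evenly over all coefficients.
    t : Carrier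
    t = c * (1# + - sum α)

    β : Fin m → Carrier
    β j = α j + t

    β-sum : sum β ≈ 1#
    β-sum = begin
      sum β                                         ≈⟨ ∑-distrib-+ α (λ _ → t) ⟩
      sum α + sum {m} (λ _ → t)                     ≈⟨ +-congˡ (sum-cong-≋ {m} (λ _ → *-identityˡ t)) ⟨
      sum α + sum {m} (λ _ → 1# * t)                ≈⟨ +-congˡ (*-distribʳ-sum {m} t (λ _ → 1#)) ⟨
      sum α + sum {m} (λ _ → 1#) * t                ≈⟨ +-congˡ (*-assoc _ c _) ⟨
      sum α + sum {m} (λ _ → 1#) * c * (1# + - sum α) ≈⟨ +-congˡ (≈-trans (*-congʳ mc≈1) (*-identityˡ _)) ⟩
      sum α + (1# + - sum α)                        ≈⟨ +-congˡ (+-comm _ _) ⟩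
      sum α + (- sum α + 1#)                        ≈⟨ +-assoc _ _ _ ⟨
      sum α + - sum α + 1#                          ≈⟨ +-congʳ (-‿inverseʳ _) ⟩
      0# + 1#                                       ≈⟨ +-identityˡ 1# ⟩
      1#                                            ∎

  -- A reduced echelon form. At the pivots the basis is an identity matrix, which forces the
  -- coefficients in `expand` to be the entries of the vector at the pivots.
  record Echelon {m} (vs : Fin m → V) : Set (c ⊔ ℓ ⊔ i) where
    field
      rank       : ℕ
      pivot      : Fin rank → I
      basis      : Fin rank → V
      spanned    : ∀ k → basis k ∈⟨ vs ⟩
      pivot-one  : ∀ k → basis k (pivot k) ≈ 1#
      pivot-zero : ∀ {j k} → j ≢ k → basis j (pivot k) ≈ 0#
      expand     : ∀ j → vs j ≈ᵥ combination (λ k → vs j (pivot k)) basis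

    combination-at-pivot : ∀ α k → combination α basis (pivot k) ≈ α k
    combination-at-pivot α k = begin
      sum (λ j → α j * basis j (pivot k)) ≈⟨ sum-single _ k (λ j j≢k → ≈-trans (*-congˡ (pivot-zero j≢k)) (zeroʳ _)) ⟩
      α k * basis k (pivot k)             ≈⟨ *-congˡ (pivot-one k) ⟩
      α k * 1#                            ≈⟨ *-identityʳ _ ⟩
      α k                                 ∎

    -- Evaluating a combination at the pivots reads off its coefficients, which gives independence
    -- without any division. The basis spans because every generator expands in it.
    hasDimension : ∀ {p} {S : Pred V p} →
      (∀ v → S v → v ∈⟨ vs ⟩) → (∀ v → v ∈⟨ vs ⟩ → S v) → HasDimension S rank
    hasDimension S⊆ ⊆S =
        basis
      , (λ k → ⊆S (basis k) (spanned k))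
      , (λ α α≈0 k → ≈-trans (≈-sym (combination-at-pivot α k)) (α≈0 (pivot k)))
      , λ v Sv → ∈⟨⟩-trans vs basis (S⊆ v Sv) (λ j → _ , expand j)

  subtract-multiple : ∀ x y z → x ≈ (x + (- y) * z) + y * z
  subtract-multiple x y z = begin
    x                          ≈⟨ +-identityʳ x ⟨
    x + 0#                     ≈⟨ +-congˡ (zeroˡ z) ⟨
    x + 0# * z                 ≈⟨ +-congˡ (*-congʳ (-‿inverseˡ y)) ⟨
    x + (- y + y) * z          ≈⟨ +-congˡ (distribʳ z (- y) y) ⟩
    x + ((- y) * z + y * z)    ≈⟨ +-assoc x _ _ ⟨
    (x + (- y) * z) + y * z    ∎

  -- The only decision that elimination makes: a vector is zero or has an invertible entry.
  module _ (pivot? : ∀ v → v ≈ᵥ 0ᵥ ⊎ ∃₂ λ x y → v x * y ≈ 1#) where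
    open Echelon

    -- Gauss–Jordan elimination, one new generator at a time.
    echelon : ∀ {m} (vs : Fin m → V) → Echelon vs
    echelon {zero} vs = record
      { rank = 0
      ; pivot = λ ()
      ; basis = λ ()
      ; spanned = λ ()
      ; pivot-one = λ ()
      ; pivot-zero = λ { {()} }
      ; expand = λ ()
      }
    echelon {suc m} vs = extend (pivot? residue)
      where
      E = echelon (vs ∘ suc)

      v₀ : V
      v₀ = vs zero

      coordinate : V → Fin (rank E) → Carrier
      coordinate v k = v (pivot E k)

      -- The new generator reduced modulo the old basis: removing its coordinates makes it vanish at
      -- every old pivot.
      residue : V
      residue x = v₀ x + sum (λ k → (- coordinate v₀ k) * basis E k x)

      basis∈ : ∀ k → basis E k ∈⟨ vs ⟩
      basis∈ k = ∈⟨⟩-trans (vs ∘ suc) vs (spanned E k) (generator∈ vs ∘ suc)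

      residue∈ : residue ∈⟨ vs ⟩
      residue∈ = ∈⟨⟩-trans (v₀ ∷ᶠ basis E) vs
        ((1# ∷ᶠ λ k → - coordinate v₀ k) , λ x → +-congʳ (≈-sym (*-identityˡ (v₀ x))))
        λ { zero → generator∈ vs zero ; (suc k) → basis∈ k }

      v₀-decomposed : ∀ x → v₀ x ≈ residue x + combination (coordinate v₀) (basis E) x
      v₀-decomposed x = begin
        v₀ x                                          ≈⟨ +-identityʳ _ ⟨
        v₀ x + 0#                                     ≈⟨ +-congˡ (sum-zero _ cancel) ⟨
        v₀ x + sum (λ k → (- coordinate v₀ k) * basis E k x + coordinate v₀ k * basis E k x)
                                                      ≈⟨ +-congˡ (∑-distrib-+ (λ k → (- coordinate v₀ k) * basis E k x) (λ k → coordinate v₀ k * basis E k x)) ⟩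
        v₀ x + (sum (λ k → (- coordinate v₀ k) * basis E k x) + combination (coordinate v₀) (basis E) x)
                                                      ≈⟨ +-assoc _ _ _ ⟨
        residue x + combination (coordinate v₀) (basis E) x  ∎
        where
        cancel : ∀ k → (- coordinate v₀ k) * basis E k x + coordinate v₀ k * basis E k x ≈ 0#
        cancel k = ≈-trans (≈-sym (distribʳ _ _ _)) (≈-trans (*-congʳ (-‿inverseˡ _)) (zeroˡ _))

      residue-at-pivot : ∀ k → residue (pivot E k) ≈ 0#
      residue-at-pivot k = begin
        v₀ (pivot E k) + combination (λ k → - coordinate v₀ k) (basis E) (pivot E k)
          ≈⟨ +-congˡ (combination-at-pivot E _ k) ⟩
        v₀ (pivot E k) + - v₀ (pivot E k)
          ≈⟨ -‿inverseʳ _ ⟩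
        0# ∎

      extend : residue ≈ᵥ 0ᵥ ⊎ ∃₂ (λ x y → residue x * y ≈ 1#) → Echelon vs
      extend (inj₁ residue≈0) = record
        { rank = rank E
        ; pivot = pivot E
        ; basis = basis E
        ; spanned = basis∈
        ; pivot-one = pivot-one E
        ; pivot-zero = pivot-zero E
        ; expand = λ
          { zero x → ≈-trans (v₀-decomposed x) (≈-trans (+-congʳ (residue≈0 x)) (+-identityˡ _))
          ; (suc j) → expand E j
          }
        }
      extend (inj₂ (x₀ , y , residue*y≈1)) = record
        { rank = suc (rank E)
        ; pivot = x₀ ∷ᶠ pivot E
        ; basis = new ∷ᶠ cleared
        ; spanned = λ { zero → new∈ ; (suc k) → cleared∈ k }
        ; pivot-one = λ { zero → new-at-x₀ ; (suc k) → ≈-trans (cleared-at-pivot k k) (pivot-one E k) }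
        ; pivot-zero = λ
          { {zero} {zero} 0≢0 → ⊥-elim (0≢0 refl)
          ; {zero} {suc k} _ → new-at-pivot k
          ; {suc j} {zero} _ → cleared-at-x₀ j
          ; {suc j} {suc k} j≢k → ≈-trans (cleared-at-pivot j k) (pivot-zero E (j≢k ∘ cong suc))
          }
        ; expand = λ
          { zero → new-expand
          ; (suc j) → old-expand j
          }
        }
        where
        -- `y` inverts the entry of the residue at `x₀`, so this is the residue scaled to have entry
        -- 1 at the new pivot.
        new : V
        new x = residue x * y

        new-at-x₀ : new x₀ ≈ 1#
        new-at-x₀ = residue*y≈1

        new-at-pivot : ∀ k → new (pivot E k) ≈ 0#
        new-at-pivot k = ≈-trans (*-congʳ (residue-at-pivot k)) (zeroˡ y)

        new∈ : new ∈⟨ vs ⟩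
        new∈ = ∈⟨⟩-trans (residue ∷ᶠ []ᶠ) vs
          ((y ∷ᶠ []ᶠ) , λ x → ≈-trans (*-comm _ _) (≈-sym (+-identityʳ _)))
          λ { zero → residue∈ }

        -- The back-substitution of Gauss-Jordan: position `x₀` is cleared from the old basis. The
        -- values at old pivots survive because `new` is zero there.
        cleared : Fin (rank E) → V
        cleared k x = basis E k x + (- basis E k x₀) * new x

        cleared∈ : ∀ k → cleared k ∈⟨ vs ⟩
        cleared∈ k = ∈⟨⟩-trans (basis E k ∷ᶠ new ∷ᶠ []ᶠ) vs
          ((1# ∷ᶠ - basis E k x₀ ∷ᶠ []ᶠ)
            , λ x → +-cong (≈-sym (*-identityˡ _)) (≈-sym (+-identityʳ _)))
          λ { zero → basis∈ k ; (suc zero) → new∈ }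

        cleared-at-pivot : ∀ j k → cleared j (pivot E k) ≈ basis E j (pivot E k)
        cleared-at-pivot j k =
          ≈-trans (+-congˡ (≈-trans (*-congˡ (new-at-pivot k)) (zeroʳ _))) (+-identityʳ _)

        cleared-at-x₀ : ∀ k → cleared k x₀ ≈ 0#
        cleared-at-x₀ k =
          ≈-trans (+-congˡ (≈-trans (*-congˡ new-at-x₀) (*-identityʳ _))) (-‿inverseʳ _)

        -- Clearing costs a multiple of `new` whose coefficient is the value of the combination at
        -- `x₀`. For an old generator this value is its own entry there, just the coefficient that
        -- `expand` prescribes for the new pivot.
        combination-cleared : ∀ α x → combination α (basis E) x
          ≈ combination α (basis E) x₀ * new x + combination α cleared x
        combination-cleared α x = begin
          sum (λ k → α k * basis E k x)
            ≈⟨ sum-cong-≋ (λ k → step (α k) (basis E k x) (basis E k x₀)) ⟩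
          sum (λ k → α k * basis E k x₀ * new x + α k * cleared k x)
            ≈⟨ ∑-distrib-+ (λ k → α k * basis E k x₀ * new x) (λ k → α k * cleared k x) ⟩
          sum (λ k → α k * basis E k x₀ * new x) + sum (λ k → α k * cleared k x)
            ≈⟨ +-congʳ (*-distribʳ-sum (new x) (λ k → α k * basis E k x₀)) ⟨
          sum (λ k → α k * basis E k x₀) * new x + sum (λ k → α k * cleared k x) ∎
          where
          step : ∀ a b b₀ → a * b ≈ a * b₀ * new x + a * (b + (- b₀) * new x)
          step a b b₀ = begin
            a * b                                              ≈⟨ *-congˡ (subtract-multiple b b₀ (new x)) ⟩
            a * ((b + (- b₀) * new x) + b₀ * new x)            ≈⟨ distribˡ _ _ _ ⟩
            a * (b + (- b₀) * new x) + a * (b₀ * new x)        ≈⟨ +-comm _ _ ⟩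
            a * (b₀ * new x) + a * (b + (- b₀) * new x)        ≈⟨ +-congʳ (*-assoc _ _ _) ⟨
            a * b₀ * new x + a * (b + (- b₀) * new x)          ∎

        old-expand : ∀ j x → vs (suc j) x ≈
          vs (suc j) x₀ * new x + combination (coordinate (vs (suc j))) cleared x
        old-expand j x = begin
          vs (suc j) x                               ≈⟨ expand E j x ⟩
          combination α (basis E) x                  ≈⟨ combination-cleared α x ⟩
          combination α (basis E) x₀ * new x + combination α cleared x
                                                     ≈⟨ +-congʳ (*-congʳ (expand E j x₀)) ⟨
          vs (suc j) x₀ * new x + combination α cleared x ∎
          where α = coordinate (vs (suc j))

        residue≈new : ∀ x → residue x ≈ residue x₀ * new x
        residue≈new x = begin
          residue x                        ≈⟨ *-identityʳ _ ⟨
          residue x * 1#                   ≈⟨ *-congˡ residue*y≈1 ⟨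
          residue x * (residue x₀ * y)     ≈⟨ *-assoc _ _ _ ⟨
          residue x * residue x₀ * y       ≈⟨ *-congʳ (*-comm _ _) ⟩
          residue x₀ * residue x * y       ≈⟨ *-assoc _ _ _ ⟩
          residue x₀ * new x               ∎

        new-expand : ∀ x → v₀ x ≈ v₀ x₀ * new x + combination (coordinate v₀) cleared x
        new-expand x = begin
          v₀ x                                                 ≈⟨ v₀-decomposed x ⟩
          residue x + combination α (basis E) x                ≈⟨ +-cong (residue≈new x) (combination-cleared α x) ⟩
          residue x₀ * new x + (combination α (basis E) x₀ * new x + combination α cleared x)
                                                               ≈⟨ +-assoc _ _ _ ⟨
          residue x₀ * new x + combination α (basis E) x₀ * new x + combination α cleared x
                                                               ≈⟨ +-congʳ (distribʳ _ _ _) ⟨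
          -- The two contributions to the coefficient of `new` are the two summands of `v₀` at `x₀`.
          (residue x₀ + combination α (basis E) x₀) * new x + combination α cleared x
                                                               ≈⟨ +-congʳ (*-congʳ (v₀-decomposed x₀)) ⟨
          v₀ x₀ * new x + combination α cleared x              ∎
          where α = coordinate v₀

-- Change of the coefficient ring

module Transport (K : CommutativeRing c ℓ) (K′ : CommutativeRing c′ ℓ′) (I : Set i)
  {φ : CommutativeRing.Carrier K → CommutativeRing.Carrier K′}
  (φ-hom : IsSemiringHomomorphism (Semiring.rawSemiring (CommutativeRing.semiring K)) (Semiring.rawSemiring (CommutativeRing.semiring K′)) φ) where
  private
    module K = CommutativeRing K
    module K′ = CommutativeRing K′
    module V = CoordinateSpace K I
    module V′ = CoordinateSpace K′ I
    module E = Elimination K I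
    module E′ = Elimination K′ I
  open IsSemiringHomomorphism φ-hom
  open SumHomomorphism K.+-monoid K′.+-monoid +-isMonoidHomomorphism using (sum-homo)
  open SemiringSum K′.semiring using (sum-cong-≋)

  combination-homo : ∀ {m} α (vs : Fin m → V.V) x →
    φ (V.combination α vs x) K′.≈ V′.combination (φ ∘ α) (λ j → φ ∘ vs j) x
  combination-homo α vs x =
    K′.trans (sum-homo (λ j → α j K.* vs j x)) (sum-cong-≋ (λ j → *-homo (α j) (vs j x)))

  -- Ones and zeros at the pivots survive a homomorphism, so the image has the same rank. This is
  -- what makes the real and complex dimensions agree.
  mapEchelon : ∀ {m} {vs : Fin m → V.V} → E.Echelon vs → E′.Echelon (λ j → φ ∘ vs j)
  mapEchelon {vs = vs} e = record
    { rank = rank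
    ; pivot = pivot
    ; basis = λ k → φ ∘ basis k
    ; spanned = λ k → let α , b≈ = spanned k in
        φ ∘ α , λ x → K′.trans (⟦⟧-cong (b≈ x)) (combination-homo α vs x)
    ; pivot-one = λ k → K′.trans (⟦⟧-cong (pivot-one k)) 1#-homo
    ; pivot-zero = λ j≢k → K′.trans (⟦⟧-cong (pivot-zero j≢k)) 0#-homo
    ; expand = λ j x → K′.trans (⟦⟧-cong (expand j x)) (combination-homo _ basis x)
    }
    where open E.Echelon e

-- Signed sums over permutations

module ListSum (R : Semiring c ℓ) where
  open Semiring R hiding (zero) renaming (refl to ≈-refl; sym to ≈-sym; trans to ≈-trans; reflexive to ≈-reflexive)
  open SemiringSum R using (sum)
  open SetoidReasoning setoid

  -- The Iverson bracket, used to turn filtered sums into weighted ones.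
  ⟦_⟧ : {P : Set p} → Dec P → Carrier
  ⟦ P? ⟧ = if does P? then 1# else 0#

  ⟦⟧-cong : {P : Set p} {Q : Set q} (P? : Dec P) (Q? : Dec Q) →
    (P → Q) → (Q → P) → ⟦ P? ⟧ ≡ ⟦ Q? ⟧
  ⟦⟧-cong (yes _) (yes _) _ _ = refl
  ⟦⟧-cong (no _)  (no _)  _ _ = refl
  ⟦⟧-cong (yes p) (no ¬q) f _ = ⊥-elim (¬q (f p))
  ⟦⟧-cong (no ¬p) (yes q) _ g = ⊥-elim (¬p (g q))

  ⟦⟧-yes : {P : Set p} (P? : Dec P) → P → ⟦ P? ⟧ ≡ 1#
  ⟦⟧-yes (yes _) _ = refl
  ⟦⟧-yes (no ¬p) p = ⊥-elim (¬p p)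

  ⟦⟧-no : {P : Set p} (P? : Dec P) → ¬ P → ⟦ P? ⟧ ≡ 0#
  ⟦⟧-no (yes p) ¬p = ⊥-elim (¬p p)
  ⟦⟧-no (no _)  _  = refl

  ⟦⟧-× : {P : Set p} {Q : Set q} (P? : Dec P) (Q? : Dec Q) →
    ⟦ P? ×-dec Q? ⟧ ≈ ⟦ P? ⟧ * ⟦ Q? ⟧
  ⟦⟧-× (yes _) Q? = ≈-sym (*-identityˡ _)
  ⟦⟧-× (no _)  Q? = ≈-sym (zeroˡ _)

  listSum : (A → Carrier) → List A → Carrier
  listSum f xs = List.foldr _+_ 0# (List.map f xs)

  listSum-cong : {f g : A → Carrier} → (∀ x → f x ≈ g x) → ∀ xs → listSum f xs ≈ listSum g xs
  listSum-cong f≈g []       = ≈-refl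
  listSum-cong f≈g (x ∷ xs) = +-cong (f≈g x) (listSum-cong f≈g xs)

  listSum-++ : (f : A → Carrier) → ∀ xs ys →
    listSum f (xs List.++ ys) ≈ listSum f xs + listSum f ys
  listSum-++ f []       ys = ≈-sym (+-identityˡ _)
  listSum-++ f (x ∷ xs) ys = ≈-trans (+-congˡ (listSum-++ f xs ys)) (≈-sym (+-assoc _ _ _))

  listSum-map : (f : B → Carrier) (g : A → B) → ∀ xs →
    listSum f (List.map g xs) ≡ listSum (f ∘ g) xs
  listSum-map f g []       = refl
  listSum-map f g (x ∷ xs) = cong (f (g x) +_) (listSum-map f g xs)

  listSum-tabulate : (f : A → Carrier) → ∀ {n} (g : Fin n → A) →
    listSum f (List.tabulate g) ≡ sum (f ∘ g)
  listSum-tabulate f {zero}  g = refl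
  listSum-tabulate f {suc n} g = cong (f (g zero) +_) (listSum-tabulate f (g ∘ suc))

  listSum-lookup : (f : A → Carrier) → ∀ xs → sum (λ j → f (List.lookup xs j)) ≡ listSum f xs
  listSum-lookup f []       = refl
  listSum-lookup f (x ∷ xs) = cong (f x +_) (listSum-lookup f xs)

  listSum-cartesianProductWith : (f : C → Carrier) (g : A → B → C) → ∀ xs ys →
    listSum f (List.cartesianProductWith g xs ys) ≈ listSum (λ x → listSum (f ∘ g x) ys) xs
  listSum-cartesianProductWith f g []       ys = ≈-refl
  listSum-cartesianProductWith f g (x ∷ xs) ys = begin
    listSum f (List.map (g x) ys List.++ List.cartesianProductWith g xs ys)
      ≈⟨ listSum-++ f (List.map (g x) ys) _ ⟩
    listSum f (List.map (g x) ys) + listSum f (List.cartesianProductWith g xs ys)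
      ≈⟨ +-cong (≈-reflexive (listSum-map f (g x) ys)) (listSum-cartesianProductWith f g xs ys) ⟩
    listSum (f ∘ g x) ys + listSum (λ z → listSum (f ∘ g z) ys) xs ∎

  listSum-filter : {P : Pred A p} (P? : Decidable P) (f : A → Carrier) → ∀ xs →
    listSum f (List.filter P? xs) ≈ listSum (λ x → ⟦ P? x ⟧ * f x) xs
  listSum-filter P? f [] = ≈-refl
  listSum-filter P? f (x ∷ xs) with P? x
  ... | yes _ = +-cong (≈-sym (*-identityˡ _)) (listSum-filter P? f xs)
  ... | no _  = ≈-trans (listSum-filter P? f xs)
                  (≈-trans (≈-sym (+-identityˡ _)) (+-congʳ (≈-sym (zeroˡ _))))

  listSum-zero : (f : A → Carrier) → ∀ {xs} → All (λ x → f x ≈ 0#) xs → listSum f xs ≈ 0#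
  listSum-zero f []           = ≈-refl
  listSum-zero f (fx≈0 ∷ f≈0) = ≈-trans (+-cong fx≈0 (listSum-zero f f≈0)) (+-identityˡ _)

  listSum-*ˡ : ∀ y (f : A → Carrier) xs → listSum (λ x → y * f x) xs ≈ y * listSum f xs
  listSum-*ˡ y f []       = ≈-sym (zeroʳ y)
  listSum-*ˡ y f (x ∷ xs) = ≈-trans (+-congˡ (listSum-*ˡ y f xs)) (≈-sym (distribˡ _ _ _))

  listSum-+ : (f g : A → Carrier) → ∀ xs → listSum (λ x → f x + g x) xs ≈ listSum f xs + listSum g xs
  listSum-+ f g []       = ≈-sym (+-identityˡ _)
  listSum-+ f g (x ∷ xs) = begin
    f x + g x + listSum (λ x → f x + g x) xs        ≈⟨ +-congˡ (listSum-+ f g xs) ⟩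
    f x + g x + (listSum f xs + listSum g xs)       ≈⟨ +-assoc _ _ _ ⟩
    f x + (g x + (listSum f xs + listSum g xs))     ≈⟨ +-congˡ (+-assoc _ _ _) ⟨
    f x + (g x + listSum f xs + listSum g xs)       ≈⟨ +-congˡ (+-congʳ (+-comm _ _)) ⟩
    f x + (listSum f xs + g x + listSum g xs)       ≈⟨ +-congˡ (+-assoc _ _ _) ⟩
    f x + (listSum f xs + (g x + listSum g xs))     ≈⟨ +-assoc _ _ _ ⟨
    f x + listSum f xs + (g x + listSum g xs)       ∎

  listSum-swap : (f : A → B → Carrier) → ∀ xs ys →
    listSum (λ x → listSum (f x) ys) xs ≈ listSum (λ y → listSum (λ x → f x y) xs) ys
  listSum-swap f []       ys = ≈-sym (listSum-zero _ (All.universal (λ _ → ≈-refl) ys))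
  listSum-swap f (x ∷ xs) ys =
    ≈-trans (+-congˡ (listSum-swap f xs ys)) (≈-sym (listSum-+ (f x) _ ys))

  listSum-indicator : (_≟_ : DecidableEquality A) → ∀ {x xs} → Unique xs → x ∈ xs →
    listSum (λ y → ⟦ x ≟ y ⟧) xs ≈ 1#
  listSum-indicator _≟_ {x} (x∉xs ∷ _) (here refl) = ≈-trans
    (+-cong (≈-reflexive (⟦⟧-yes (x ≟ x) refl))
      (listSum-zero _ (All.map (λ {y} x≢y → ≈-reflexive (⟦⟧-no (x ≟ y) x≢y)) x∉xs)))
    (+-identityʳ 1#)
  listSum-indicator _≟_ {x} {y ∷ _} (y∉ys ∷ ys!) (there x∈ys) = ≈-trans
    (+-cong (≈-reflexive (⟦⟧-no (x ≟ y) λ x≡y → All.lookup y∉ys x∈ys (sym x≡y)))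
      (listSum-indicator _≟_ ys! x∈ys))
    (+-identityˡ 1#)

module ℕ-Sum where
  open SemiringSum ℕ.+-*-semiring public
  open ListSum ℕ.+-*-semiring public

module ℤ-Sum where
  open SemiringSum ℤ.+-*-semiring public
  open ListSum ℤ.+-*-semiring public

-- Inversions and signs of permutations built by insertion

module _ where
  open ℕ-Sum
  open ≡-Reasoning

  length≡listSum : (xs : List A) → List.length xs ≡ listSum (λ _ → 1) xs
  length≡listSum []       = refl
  length≡listSum (x ∷ xs) = cong suc (length≡listSum xs)

  -- The test inside `inversions`, repeated so that the two filters agree definitionally.
  inverted? : ∀ {n} (σ : Permutation′ n) (jk : Fin n × Fin n) →
    Dec ((proj₁ jk Fin.< proj₂ jk) × ((σ ⟨$⟩ʳ proj₂ jk) Fin.< (σ ⟨$⟩ʳ proj₁ jk)))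
  inverted? σ (j , k) = (j Fin.<? k) ×-dec ((σ ⟨$⟩ʳ k) Fin.<? (σ ⟨$⟩ʳ j))

  inversions-sum : ∀ {n} (σ : Permutation′ n) →
    inversions σ ≡ sum (λ j → sum (λ k → ⟦ inverted? σ (j , k) ⟧))
  inversions-sum {n} σ = begin
    inversions σ
      ≡⟨ length≡listSum (List.filter (inverted? σ) pairs) ⟩
    listSum (λ _ → 1) (List.filter (inverted? σ) pairs)
      ≡⟨ listSum-filter (inverted? σ) (λ _ → 1) pairs ⟩
    listSum (λ jk → ⟦ inverted? σ jk ⟧ ℕ.* 1) pairs
      ≡⟨ listSum-cong (λ jk → ℕ.*-identityʳ ⟦ inverted? σ jk ⟧) pairs ⟩
    listSum (λ jk → ⟦ inverted? σ jk ⟧) pairs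
      ≡⟨ listSum-cartesianProductWith (λ jk → ⟦ inverted? σ jk ⟧) _,_ (List.allFin n) (List.allFin n) ⟩
    listSum (λ j → listSum (λ k → ⟦ inverted? σ (j , k) ⟧) (List.allFin n)) (List.allFin n)
      ≡⟨ listSum-tabulate (λ j → listSum (λ k → ⟦ inverted? σ (j , k) ⟧) (List.allFin n)) id ⟩
    sum (λ j → listSum (λ k → ⟦ inverted? σ (j , k) ⟧) (List.allFin n))
      ≡⟨ sum-cong-≗ (λ j → listSum-tabulate (λ k → ⟦ inverted? σ (j , k) ⟧) id) ⟩
    sum (λ j → sum (λ k → ⟦ inverted? σ (j , k) ⟧)) ∎
    where
    pairs = List.cartesianProduct (List.allFin n) (List.allFin n)

  punchIn-<-pivot⁻ : ∀ {n} (j : Fin (suc n)) c → punchIn j c Fin.< j → toℕ c ℕ.< toℕ j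
  punchIn-<-pivot⁻ (suc j) zero    _       = ℕ.s≤s ℕ.z≤n
  punchIn-<-pivot⁻ (suc j) (suc c) (ℕ.s≤s lt) = ℕ.s≤s (punchIn-<-pivot⁻ j c lt)

  punchIn-<-pivot⁺ : ∀ {n} (j : Fin (suc n)) c → toℕ c ℕ.< toℕ j → punchIn j c Fin.< j
  punchIn-<-pivot⁺ (suc j) zero    _       = ℕ.s≤s ℕ.z≤n
  punchIn-<-pivot⁺ (suc j) (suc c) (ℕ.s≤s lt) = ℕ.s≤s (punchIn-<-pivot⁺ j c lt)

  punchIn-mono-< : ∀ {n} (j : Fin (suc n)) {c d} → c Fin.< d → punchIn j c Fin.< punchIn j d
  punchIn-mono-< j {c} {d} c<d = ℕ.≰⇒> (λ le → ℕ.<⇒≱ c<d (Fin.punchIn-cancel-≤ j d c le))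

  punchIn-cancel-< : ∀ {n} (j : Fin (suc n)) {c d} → punchIn j c Fin.< punchIn j d → c Fin.< d
  punchIn-cancel-< j {c} {d} lt = ℕ.≰⇒> (λ d≤c → ℕ.<⇒≱ lt (Fin.punchIn-mono-≤ j d c d≤c))

  count-below : ∀ {n} (j : Fin (suc n)) → sum {n} (λ c → ⟦ toℕ c ℕ.<? toℕ j ⟧) ≡ toℕ j
  count-below {n}     zero    = trans
    (sum-cong-≗ {n} (λ c → ⟦⟧-no (toℕ c ℕ.<? 0) λ ())) (sum-replicate-zero n)
  count-below {suc n} (suc j) = cong suc (trans
    (sum-cong-≗ {n} (λ c → ⟦⟧-cong (suc (toℕ c) ℕ.<? suc (toℕ j)) (toℕ c ℕ.<? toℕ j) ℕ.s<s⁻¹ ℕ.s<s))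
    (count-below j))

  -- Position zero, sent to `j`, is inverted with exactly those positions whose image lies below
  -- `j`, and there are `toℕ j` of them. Among the other positions nothing changes, since
  -- `punchIn j` preserves and reflects order.
  inversions-insert : ∀ {n} (j : Fin (suc n)) (π : Permutation′ n) →
    inversions (Perm.insert zero j π) ≡ toℕ j ℕ.+ inversions π
  inversions-insert {n} j π = begin
    inversions σ
      ≡⟨ inversions-sum σ ⟩
    -- Terms whose second index is zero have already computed to 0, as no index lies below zero.
    sum (λ k → ⟦ inverted? σ (zero , suc k) ⟧) ℕ.+ sum (λ i → sum (λ k → ⟦ inverted? σ (suc i , suc k) ⟧))
      ≡⟨ cong₂ ℕ._+_
           (sum-cong-≗ (λ k → ⟦⟧-cong (inverted? σ (zero , suc k)) (toℕ (π ⟨$⟩ʳ k) ℕ.<? toℕ j)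
             (λ (_ , lt) → punchIn-<-pivot⁻ j _ lt) (λ lt → ℕ.s≤s ℕ.z≤n , punchIn-<-pivot⁺ j _ lt)))
           (sum-cong-≗ (λ i → sum-cong-≗ (λ k → ⟦⟧-cong (inverted? σ (suc i , suc k)) (inverted? π (i , k))
             (λ (i<k , lt) → ℕ.s<s⁻¹ i<k , punchIn-cancel-< j lt)
             (λ (i<k , lt) → ℕ.s<s i<k , punchIn-mono-< j lt)))) ⟩
    sum (λ k → ⟦ toℕ (π ⟨$⟩ʳ k) ℕ.<? toℕ j ⟧) ℕ.+ sum (λ i → sum (λ k → ⟦ inverted? π (i , k) ⟧))
      ≡⟨ cong₂ ℕ._+_ (sum-permute (λ c → ⟦ toℕ c ℕ.<? toℕ j ⟧) π) (inversions-sum π) ⟨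
    sum {n} (λ c → ⟦ toℕ c ℕ.<? toℕ j ⟧) ℕ.+ inversions π
      ≡⟨ cong (ℕ._+ inversions π) (count-below j) ⟩
    toℕ j ℕ.+ inversions π ∎
    where
    σ = Perm.insert zero j π

parity : ∀ {n} → Fin n → ℤ
parity j = -1ℤ ℤ.^ toℕ j

-- The factor `parity j` is the cofactor sign of a Laplace expansion.
sign-insert : ∀ {n} (j : Fin (suc n)) (π : Permutation′ n) →
  sign (Perm.insert zero j π) ≡ parity j ℤ.* sign π
sign-insert j π = trans (cong (-1ℤ ℤ.^_) (inversions-insert j π))
  (ℤ.^-distribˡ-+-* -1ℤ (toℕ j) (inversions π))

parity-suc : ∀ {n} (j : Fin n) → parity (suc j) ≡ ℤ.- parity j
parity-suc j = ℤ.-1*i≡-i (parity j)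

-- Adjacent transpositions

adjacentSwap : ∀ {n} → Fin n → Fin (suc n) → Fin (suc n)
adjacentSwap zero    zero          = suc zero
adjacentSwap zero    (suc zero)    = zero
adjacentSwap zero    (suc (suc i)) = suc (suc i)
adjacentSwap (suc k) zero          = zero
adjacentSwap (suc k) (suc i)       = suc (adjacentSwap k i)

adjacentSwap-involutive : ∀ {n} (k : Fin n) i → adjacentSwap k (adjacentSwap k i) ≡ i
adjacentSwap-involutive zero    zero          = refl
adjacentSwap-involutive zero    (suc zero)    = refl
adjacentSwap-involutive zero    (suc (suc i)) = refl
adjacentSwap-involutive (suc k) zero          = refl
adjacentSwap-involutive (suc k) (suc i)       = cong suc (adjacentSwap-involutive k i)

adjacentTransposition : ∀ {n} → Fin n → Permutation′ (suc n)
adjacentTransposition k = Perm.permutation (adjacentSwap k) (adjacentSwap k)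
  (adjacentSwap-involutive k) (adjacentSwap-involutive k)

adjacentSwap-suc : ∀ {n} (k : Fin n) → adjacentSwap k (inject₁ k) ≡ suc k
adjacentSwap-suc zero    = refl
adjacentSwap-suc (suc k) = cong suc (adjacentSwap-suc k)

adjacentSwap-below : ∀ {n} (k : Fin n) {i} → i Fin.< inject₁ k → adjacentSwap k i ≡ i
adjacentSwap-below (suc k) {zero}  _          = refl
adjacentSwap-below (suc k) {suc i} (ℕ.s≤s lt) = cong suc (adjacentSwap-below k lt)

adjacentSwap-invariant : ∀ {n} (r : Fin (suc n) → A) k → r (inject₁ k) ≡ r (suc k) →
  r ∘ adjacentSwap k ≗ r
adjacentSwap-invariant r zero    eq zero          = sym eq
adjacentSwap-invariant r zero    eq (suc zero)    = eq
adjacentSwap-invariant r zero    eq (suc (suc i)) = refl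
adjacentSwap-invariant r (suc k) eq zero          = refl
adjacentSwap-invariant r (suc k) eq (suc i)       = adjacentSwap-invariant (r ∘ suc) k eq i

-- How deleting index `j` interacts with a swap. If `j` belongs to the swapped pair, the swap turns
-- into deletion of its neighbour, of opposite parity. Otherwise `j` stays fixed and the swap
-- becomes an adjacent swap of the remaining indices.
adjacentSwap-punchIn : ∀ {m} (k : Fin (suc m)) (j : Fin (suc (suc m))) →
    (adjacentSwap k ∘ punchIn j ≗ punchIn (adjacentSwap k j) × parity j ≡ ℤ.- parity (adjacentSwap k j))
  ⊎ (adjacentSwap k j ≡ j × ∃[ l ] (adjacentSwap k ∘ punchIn j ≗ punchIn j ∘ adjacentSwap l))
adjacentSwap-punchIn zero zero = inj₁ ((λ { zero → refl ; (suc i) → refl }) , refl)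
adjacentSwap-punchIn zero (suc zero) = inj₁ ((λ { zero → refl ; (suc i) → refl }) , refl)
adjacentSwap-punchIn {suc m} zero (suc (suc j)) =
  inj₂ (refl , zero , λ { zero → refl ; (suc zero) → refl ; (suc (suc i)) → refl })
adjacentSwap-punchIn {suc m} (suc k) zero = inj₂ (refl , k , λ _ → refl)
adjacentSwap-punchIn {suc m} (suc k) (suc j) with adjacentSwap-punchIn k j
... | inj₁ (eq , flip) = inj₁
  ( (λ { zero → refl ; (suc i) → cong suc (eq i) })
  , trans (parity-suc j) (cong ℤ.-_ (trans flip (sym (parity-suc (adjacentSwap k j))))))
... | inj₂ (fixed , l , eq) = inj₂
  (cong suc fixed , suc l , λ { zero → refl ; (suc i) → cong suc (eq i) })

-- An alternating Laplace expansion

module SignedCount {A : Set a} (_≟_ : DecidableEquality A) where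
  open ℤ-Sum
  open ≡-Reasoning

  -- The Laplace expansion of the sum of sign σ over the σ with r (σ i) = wᵢ for all i.
  signedCount : ∀ {n} → Vec A n → (Fin n → A) → ℤ
  signedCount []      r = 1ℤ
  signedCount (x ∷ w) r = sum (λ j → (parity j ℤ.* ⟦ r j ≟ x ⟧) ℤ.* signedCount w (r ∘ punchIn j))

  signedCount-cong : ∀ {n} (w : Vec A n) {r s} → r ≗ s → signedCount w r ≡ signedCount w s
  signedCount-cong []      r≗s = refl
  signedCount-cong (x ∷ w) r≗s = sum-cong-≗ λ j → cong₂ ℤ._*_
    (cong (λ y → parity j ℤ.* ⟦ y ≟ x ⟧) (r≗s j)) (signedCount-cong w (r≗s ∘ punchIn j))

  sum-neg : ∀ {n} (t : Fin n → ℤ) → sum (λ j → ℤ.- t j) ≡ ℤ.- sum t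
  sum-neg {zero}  t = refl
  sum-neg {suc n} t = trans (cong (λ z → (ℤ.- t zero) ℤ.+ z) (sum-neg (t ∘ suc)))
    (sym (ℤ.neg-distrib-+ (t zero) (sum (t ∘ suc))))

  -- After reindexing by the swap, each term of the expansion is negated: through the parity of the
  -- deleted index if the swap moves it, and through the smaller minor, by induction, if it does
  -- not.
  signedCount-swap : ∀ {n} (w : Vec A (suc n)) r k →
    signedCount w (r ∘ adjacentSwap k) ≡ ℤ.- signedCount w r
  signedCount-swap {suc m} (x ∷ w) r k = begin
    sum (λ j → (parity j ℤ.* ⟦ r (s j) ≟ x ⟧) ℤ.* signedCount w (r ∘ s ∘ punchIn j))
      ≡⟨ sum-cong-≗ term-swap ⟩
    sum (λ j → ℤ.- term (s j))
      ≡⟨ sum-neg (term ∘ s) ⟩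
    ℤ.- sum (term ∘ s)
      ≡⟨ cong ℤ.-_ (sum-permute term (adjacentTransposition k)) ⟨
    ℤ.- sum term ∎
    where
    s = adjacentSwap k

    term : Fin (suc (suc m)) → ℤ
    term j = (parity j ℤ.* ⟦ r j ≟ x ⟧) ℤ.* signedCount w (r ∘ punchIn j)

    term-swap : ∀ j →
      (parity j ℤ.* ⟦ r (s j) ≟ x ⟧) ℤ.* signedCount w (r ∘ s ∘ punchIn j) ≡ ℤ.- term (s j)
    term-swap j with adjacentSwap-punchIn k j
    ... | inj₁ (eq , flip) = begin
      (parity j ℤ.* ⟦ r (s j) ≟ x ⟧) ℤ.* signedCount w (r ∘ s ∘ punchIn j)
        ≡⟨ cong₂ (λ y z → (y ℤ.* ⟦ r (s j) ≟ x ⟧) ℤ.* z) flip (signedCount-cong w (cong r ∘ eq)) ⟩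
      ((ℤ.- parity (s j)) ℤ.* ⟦ r (s j) ≟ x ⟧) ℤ.* signedCount w (r ∘ punchIn (s j))
        ≡⟨ cong (ℤ._* signedCount w (r ∘ punchIn (s j))) (ℤ.neg-distribˡ-* (parity (s j)) _) ⟨
      (ℤ.- (parity (s j) ℤ.* ⟦ r (s j) ≟ x ⟧)) ℤ.* signedCount w (r ∘ punchIn (s j))
        ≡⟨ ℤ.neg-distribˡ-* (parity (s j) ℤ.* ⟦ r (s j) ≟ x ⟧) _ ⟨
      ℤ.- term (s j) ∎
    ... | inj₂ (fixed , l , eq) = begin
      (parity j ℤ.* ⟦ r (s j) ≟ x ⟧) ℤ.* signedCount w (r ∘ s ∘ punchIn j)
        ≡⟨ cong₂ (λ i z → (parity j ℤ.* ⟦ r i ≟ x ⟧) ℤ.* z) fixed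
             (trans (signedCount-cong w (cong r ∘ eq)) (signedCount-swap w (r ∘ punchIn j) l)) ⟩
      (parity j ℤ.* ⟦ r j ≟ x ⟧) ℤ.* (ℤ.- signedCount w (r ∘ punchIn j))
        ≡⟨ ℤ.neg-distribʳ-* (parity j ℤ.* ⟦ r j ≟ x ⟧) _ ⟨
      ℤ.- term j
        ≡⟨ cong (ℤ.-_ ∘ term) fixed ⟨
      ℤ.- term (s j) ∎

  self-negative⇒0 : ∀ {z} → z ≡ ℤ.- z → z ≡ 0ℤ
  self-negative⇒0 {ℤ.+ zero} _ = refl

  -- Swapping equal neighbours leaves `r` unchanged yet negates the count.
  signedCount-adjacent : ∀ {n} (w : Vec A (suc n)) r k → r (inject₁ k) ≡ r (suc k) →
    signedCount w r ≡ 0ℤ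
  signedCount-adjacent w r k eq = self-negative⇒0 (trans
    (sym (signedCount-cong w (adjacentSwap-invariant r k eq))) (signedCount-swap w r k))

  -- The later of the two equal letters is moved left by adjacent swaps, each costing a sign, until
  -- it stands next to the earlier one. The position `t` is carried as a number so that the
  -- recursion is structural.
  signedCount-repeated-< : ∀ {n} t (w : Vec A n) r i j → toℕ j ≡ t → i Fin.< j → r i ≡ r j →
    signedCount w r ≡ 0ℤ
  signedCount-repeated-< {suc n} (suc t) w r i (suc j) j≡t i<j eq with i Fin.≟ inject₁ j
  ... | yes refl = signedCount-adjacent w r j eq
  ... | no i≢j   = begin
    signedCount w r                              ≡⟨ ℤ.neg-involutive _ ⟨
    ℤ.- (ℤ.- signedCount w r)                    ≡⟨ cong ℤ.-_ (signedCount-swap w r j) ⟨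
    ℤ.- signedCount w (r ∘ adjacentSwap j)       ≡⟨ cong ℤ.-_ (signedCount-repeated-< t w (r ∘ adjacentSwap j) i (inject₁ j)
                                                      (trans (Fin.toℕ-inject₁ j) (ℕ.suc-injective j≡t)) i<j′
                                                      (trans (cong r (adjacentSwap-below j i<j′))
                                                        (trans eq (cong r (sym (adjacentSwap-suc j)))))) ⟩
    0ℤ                                           ∎
    where
    i<j′ : i Fin.< inject₁ j
    i<j′ = ℕ.≤∧≢⇒< (subst (toℕ i ℕ.≤_) (sym (Fin.toℕ-inject₁ j)) (ℕ.s≤s⁻¹ i<j)) (i≢j ∘ Fin.toℕ-injective)

  signedCount-repeated : ∀ {n} (w : Vec A n) r {i j} → i ≢ j → r i ≡ r j → signedCount w r ≡ 0ℤ
  signedCount-repeated w r {i} {j} i≢j eq with Fin.<-cmp i j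
  ... | tri< i<j _ _ = signedCount-repeated-< _ w r i j refl i<j eq
  ... | tri≈ _ i≡j _ = ⊥-elim (i≢j i≡j)
  ... | tri> _ _ j<i = signedCount-repeated-< _ w r j i refl j<i (sym eq)

  -- For `lookup r` this is `σ • w ≡ r`, phrased with the forward map of `σ` so that it splits at
  -- position zero of an inserted permutation.
  Matches : ∀ {n} → Vec A n → (Fin n → A) → Permutation′ n → Set a
  Matches w r σ = ∀ i → r (σ ⟨$⟩ʳ i) ≡ lookup w i

  matches? : ∀ {n} (w : Vec A n) r σ → Dec (Matches w r σ)
  matches? w r σ = Fin.all? (λ i → r (σ ⟨$⟩ʳ i) ≟ lookup w i)

  matches-insert : ∀ {n} x (w : Vec A n) r j π →
    ⟦ matches? (x ∷ w) r (Perm.insert zero j π) ⟧ ≡ ⟦ r j ≟ x ⟧ ℤ.* ⟦ matches? w (r ∘ punchIn j) π ⟧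
  matches-insert x w r j π = trans
    (⟦⟧-cong (matches? (x ∷ w) r (Perm.insert zero j π)) ((r j ≟ x) ×-dec matches? w (r ∘ punchIn j) π)
      (λ m → m zero , m ∘ suc) (λ { (eq , m) zero → eq ; (eq , m) (suc i) → m i }))
    (⟦⟧-× (r j ≟ x) (matches? w (r ∘ punchIn j) π))

  -- For the permutations sending zero to `j`, both the matching condition and the sign factor into
  -- a part depending on `j` and the same quantity for the remaining letters.
  signedCount-correct : ∀ {n} (w : Vec A n) r →
    listSum (λ σ → ⟦ matches? w r σ ⟧ ℤ.* sign σ) (permutations n) ≡ signedCount w r
  signedCount-correct [] r = refl
  signedCount-correct {suc n} (x ∷ w) r = begin
    listSum term (permutations (suc n))
      ≡⟨ listSum-cartesianProductWith term (Perm.insert zero) (List.allFin (suc n)) (permutations n) ⟩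
    listSum (λ j → listSum (term ∘ Perm.insert zero j) (permutations n)) (List.allFin (suc n))
      ≡⟨ listSum-tabulate (λ j → listSum (term ∘ Perm.insert zero j) (permutations n)) id ⟩
    sum (λ j → listSum (term ∘ Perm.insert zero j) (permutations n))
      ≡⟨ sum-cong-≗ (λ j → listSum-cong (term-insert j) (permutations n)) ⟩
    sum (λ j → listSum (λ π → (parity j ℤ.* ⟦ r j ≟ x ⟧) ℤ.* (⟦ matches? w (r ∘ punchIn j) π ⟧ ℤ.* sign π)) (permutations n))
      ≡⟨ sum-cong-≗ (λ j → trans
           (listSum-*ˡ (parity j ℤ.* ⟦ r j ≟ x ⟧) (λ π → ⟦ matches? w (r ∘ punchIn j) π ⟧ ℤ.* sign π) (permutations n))
           (cong ((parity j ℤ.* ⟦ r j ≟ x ⟧) ℤ.*_) (signedCount-correct w (r ∘ punchIn j)))) ⟩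
    signedCount (x ∷ w) r ∎
    where
    term : Permutation′ (suc n) → ℤ
    term σ = ⟦ matches? (x ∷ w) r σ ⟧ ℤ.* sign σ

    open CommutativeSemigroupProperties ℤ.*-commutativeSemigroup using (interchange)

    term-insert : ∀ j π → term (Perm.insert zero j π) ≡
      (parity j ℤ.* ⟦ r j ≟ x ⟧) ℤ.* (⟦ matches? w (r ∘ punchIn j) π ⟧ ℤ.* sign π)
    term-insert j π = begin
      ⟦ matches? (x ∷ w) r (Perm.insert zero j π) ⟧ ℤ.* sign (Perm.insert zero j π)
        ≡⟨ cong₂ ℤ._*_ (matches-insert x w r j π) (sign-insert j π) ⟩
      (⟦ r j ≟ x ⟧ ℤ.* ⟦ matches? w (r ∘ punchIn j) π ⟧) ℤ.* (parity j ℤ.* sign π)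
        ≡⟨ interchange ⟦ r j ≟ x ⟧ _ (parity j) _ ⟩
      (⟦ r j ≟ x ⟧ ℤ.* parity j) ℤ.* (⟦ matches? w (r ∘ punchIn j) π ⟧ ℤ.* sign π)
        ≡⟨ cong (ℤ._* (⟦ matches? w (r ∘ punchIn j) π ⟧ ℤ.* sign π)) (ℤ.*-comm ⟦ r j ≟ x ⟧ (parity j)) ⟩
      (parity j ℤ.* ⟦ r j ≟ x ⟧) ℤ.* (⟦ matches? w (r ∘ punchIn j) π ⟧ ℤ.* sign π) ∎

-- Finite enumeration of rearrangements

permutations-complete : ∀ n (σ : Permutation′ n) → ∃[ τ ] (τ ∈ permutations n × τ Perm.≈ σ)
permutations-complete zero    σ = Perm.id , here refl , λ ()
permutations-complete (suc n) σ with permutations-complete n (Perm.remove zero σ)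
... | τ , τ∈ , τ≈ =
    Perm.insert zero (σ ⟨$⟩ʳ zero) τ
  , ∈-cartesianProductWith⁺ (Perm.insert zero) (∈-allFin (σ ⟨$⟩ʳ zero)) τ∈
  , λ { zero    → refl
      ; (suc k) → trans (cong (punchIn (σ ⟨$⟩ʳ zero)) (τ≈ k)) (sym (Perm.punchIn-permute σ zero k)) }

-- The enumeration reaches a permutation only up to `Perm.≈`, which compares forward maps, whereas
-- the action uses inverses.
•-cong : ∀ {n} {τ σ : Permutation′ n} (w : Word A n) → τ Perm.≈ σ → τ • w ≡ σ • w
•-cong {τ = τ} {σ} w τ≈σ = Vec.tabulate-cong λ j → cong (lookup w) (begin
  τ ⟨$⟩ˡ j                        ≡⟨ Perm.inverseˡ σ ⟨
  σ ⟨$⟩ˡ (σ ⟨$⟩ʳ (τ ⟨$⟩ˡ j))      ≡⟨ cong (σ ⟨$⟩ˡ_) (τ≈σ (τ ⟨$⟩ˡ j)) ⟨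
  σ ⟨$⟩ˡ (τ ⟨$⟩ʳ (τ ⟨$⟩ˡ j))      ≡⟨ cong (σ ⟨$⟩ˡ_) (Perm.inverseʳ τ) ⟩
  σ ⟨$⟩ˡ j                        ∎)
  where open ≡-Reasoning

lookup-• : ∀ {n} (σ : Permutation′ n) (w : Word A n) i → lookup (σ • w) (σ ⟨$⟩ʳ i) ≡ lookup w i
lookup-• σ w i = trans (Vec.lookup∘tabulate (λ j → lookup w (σ ⟨$⟩ˡ j)) (σ ⟨$⟩ʳ i))
  (cong (lookup w) (Perm.inverseˡ σ))

module Orbit {A : Set a} (_≟_ : DecidableEquality A) {n} (w : Word A n) where
  _≟ʷ_ : DecidableEquality (Word A n)
  _≟ʷ_ = Vec.≡-dec _≟_

  open DecMembership _≟ʷ_ using (_∈?_)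

  -- Deduplicated, so that each permutation hits exactly one entry when a sum runs over the orbit.
  orbit : List (Word A n)
  orbit = List.deduplicate _≟ʷ_ (List.map (_• w) (permutations n))

  •∈orbit : ∀ σ → σ • w ∈ orbit
  •∈orbit σ with τ , τ∈ , τ≈σ ← permutations-complete n σ =
    ∈-deduplicate⁺ _≟ʷ_ (subst (_∈ List.map (_• w) (permutations n)) (•-cong {τ = τ} {σ} w τ≈σ) (∈-map⁺ (_• w) τ∈))

  orbit⇒• : ∀ {u} → u ∈ orbit → ∃[ σ ] σ • w ≡ u
  orbit⇒• u∈ with σ , _ , u≡ ← ∈-map⁻ (_• w) (∈-deduplicate⁻ _≟ʷ_ _ u∈) = σ , sym u≡

  size : ℕ
  size = List.length orbit

  rearrangements : Fin size → Rearrangement w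
  rearrangements j = rearrangement (List.lookup orbit j) (orbit⇒• (∈-lookup {xs = orbit} j))

  -- The permutation stored in a rearrangement is irrelevant and cannot be extracted. Membership in
  -- a finite list of words is decidable, so its proof can be recomputed.
  word∈orbit : (r : Rearrangement w) → word r ∈ orbit
  word∈orbit (rearrangement u u∈) =
    recompute (u ∈? orbit) (subst (_∈ orbit) (proj₂ u∈) (•∈orbit (proj₁ u∈)))

  rearrangements-onto : ∀ r → ∃[ j ] rearrangements j ≡ r
  rearrangements-onto r = Any.index (word∈orbit r) , same r _ (sym (lookup-index (word∈orbit r)))
    where
    same : ∀ r (s : Rearrangement w) → word s ≡ word r → s ≡ r
    same _ _ refl = refl

  -- Shows that the orbit is nonempty, so that the number of columns can be inverted.
  position : Fin size
  position = Any.index (•∈orbit Perm.id)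

-- From a large part to a repeated letter

count-witness : {P : Pred A p} (P? : Decidable P) → ∀ {n} (w : Vec A n) →
  1 ≤ Vec.count P? w → ∃[ i ] P (lookup w i)
count-witness P? (x ∷ w) le with P? x
... | yes Px = zero , Px
... | no _ with i , Pi ← count-witness P? w le = suc i , Pi

count-two-witnesses : {P : Pred A p} (P? : Decidable P) → ∀ {n} (w : Vec A n) →
  2 ≤ Vec.count P? w → ∃₂ λ i j → i Fin.< j × P (lookup w i) × P (lookup w j)
count-two-witnesses P? (x ∷ w) le with P? x
... | yes Px with j , Pj ← count-witness P? w (ℕ.s≤s⁻¹ le) = zero , suc j , ℕ.s≤s ℕ.z≤n , Px , Pj
... | no _ with i , j , i<j , Pi , Pj ← count-two-witnesses P? w le = suc i , suc j , ℕ.s≤s i<j , Pi , Pj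

ones : ∀ ps → All (1 ≤_) ps → All (ℕ._< 2) ps → ps ≡ replicate (ListAction.sum ps) 1
ones []       []                []                            = refl
ones (1 ∷ ps) (_ ∷ pos)         (_ ∷ small)                   = cong (1 ∷_) (ones ps pos small)
ones (suc (suc _) ∷ _) _        (ℕ.s≤s (ℕ.s≤s ()) ∷ _)

-- Positive parts that are all below 2 are ones, and the total then fixes their number.
large-part : ∀ {n} (Λ : Partition n) → parts Λ ≢ replicate n 1 → Any (2 ≤_) (parts Λ)
large-part Λ ≢ones with any? (2 ℕ.≤?_) (parts Λ)
... | yes large = large
... | no ¬large = ⊥-elim (≢ones (trans
  (ones (parts Λ) (positive Λ) (All.map ℕ.≰⇒> (¬Any⇒All¬ _ ¬large)))
  (cong (λ m → replicate m 1) (total Λ))))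

module _ {A : Set a} (_≟_ : DecidableEquality A) where
  repeated-letter : ∀ {n} (Λ : Partition n) → parts Λ ≢ replicate n 1 →
    (w : Word A n) → HasMultiplicities _≟_ w (parts Λ) →
    ∃₂ λ i j → i ≢ j × lookup w i ≡ lookup w j
  repeated-letter Λ ≢ones w (ρ , mults)
    with x , 2≤ ← Any.satisfied (map⁻ {f = occurrences _≟_ w} (subst (Any (2 ≤_)) (sym mults) (large-part Λ ≢ones)))
    with i , j , i<j , x≡i , x≡j ← count-two-witnesses (x ≟_) w 2≤
    = i , j , Fin.<⇒≢ i<j , trans (sym x≡i) x≡j

  -- The sum of the columns

  open SignedCount _≟_

  open Orbit _≟_
  open ℤ-Sum
  open ≡-Reasoning

  matches⇒• : ∀ {n} (w r : Word A n) σ → Matches w (lookup r) σ → σ • w ≡ r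
  matches⇒• w r σ m = begin
    Vec.tabulate (λ j → lookup w (σ ⟨$⟩ˡ j))                ≡⟨ Vec.tabulate-cong (λ j → m (σ ⟨$⟩ˡ j)) ⟨
    Vec.tabulate (λ j → lookup r (σ ⟨$⟩ʳ (σ ⟨$⟩ˡ j)))       ≡⟨ Vec.tabulate-cong (λ j → cong (lookup r) (Perm.inverseʳ σ)) ⟩
    Vec.tabulate (lookup r)                                 ≡⟨ Vec.tabulate∘lookup r ⟩
    r                                                       ∎

  •⇒matches : ∀ {n} (w r : Word A n) σ → σ • w ≡ r → Matches w (lookup r) σ
  •⇒matches w _ σ refl = lookup-• σ w

  -- Each `σ` with `σ • w₁ ≡ r₁` contributes to the single column `σ • w₂`, so summing over all
  -- columns removes the condition on the second word.
  sum-youngCharacter : ∀ {n} (w₁ w₂ r₁ : Word A n) →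
    listSum (youngCharacter _≟_ w₁ w₂ r₁) (orbit w₂) ≡ signedCount w₁ (lookup r₁)
  sum-youngCharacter {n} w₁ w₂ r₁ = begin
    listSum (youngCharacter _≟_ w₁ w₂ r₁) (orbit w₂)
      ≡⟨ listSum-cong (λ u → listSum-filter (λ σ → (σ • w₁ ≟ₙ r₁) ×-dec (σ • w₂ ≟ₙ u)) sign (permutations n)) (orbit w₂) ⟩
    listSum (λ u → listSum (λ σ → ⟦ (σ • w₁ ≟ₙ r₁) ×-dec (σ • w₂ ≟ₙ u) ⟧ ℤ.* sign σ) (permutations n)) (orbit w₂)
      ≡⟨ listSum-swap (λ u σ → ⟦ (σ • w₁ ≟ₙ r₁) ×-dec (σ • w₂ ≟ₙ u) ⟧ ℤ.* sign σ) (orbit w₂) (permutations n) ⟩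
    listSum (λ σ → listSum (λ u → ⟦ (σ • w₁ ≟ₙ r₁) ×-dec (σ • w₂ ≟ₙ u) ⟧ ℤ.* sign σ) (orbit w₂)) (permutations n)
      ≡⟨ listSum-cong (λ σ → trans
           (listSum-cong (factor σ) (orbit w₂))
           (listSum-*ˡ (⟦ matches? w₁ (lookup r₁) σ ⟧ ℤ.* sign σ) (λ u → ⟦ σ • w₂ ≟ₙ u ⟧) (orbit w₂))) (permutations n) ⟩
    listSum (λ σ → (⟦ matches? w₁ (lookup r₁) σ ⟧ ℤ.* sign σ) ℤ.* listSum (λ u → ⟦ σ • w₂ ≟ₙ u ⟧) (orbit w₂)) (permutations n)
      ≡⟨ listSum-cong (λ σ → trans
           (cong ((⟦ matches? w₁ (lookup r₁) σ ⟧ ℤ.* sign σ) ℤ.*_)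
             (listSum-indicator _≟ₙ_ (deduplicate-! _≟ₙ_ (List.map (_• w₂) (permutations n))) (•∈orbit w₂ σ)))
           (ℤ.*-identityʳ _)) (permutations n) ⟩
    listSum (λ σ → ⟦ matches? w₁ (lookup r₁) σ ⟧ ℤ.* sign σ) (permutations n)
      ≡⟨ signedCount-correct w₁ (lookup r₁) ⟩
    signedCount w₁ (lookup r₁) ∎
    where
    infix 4 _≟ₙ_
    _≟ₙ_ : DecidableEquality (Word A n)
    _≟ₙ_ = Vec.≡-dec _≟_

    open CommutativeSemigroupProperties ℤ.*-commutativeSemigroup using (xy∙z≈xz∙y)

    factor : ∀ σ u → ⟦ (σ • w₁ ≟ₙ r₁) ×-dec (σ • w₂ ≟ₙ u) ⟧ ℤ.* sign σ
      ≡ (⟦ matches? w₁ (lookup r₁) σ ⟧ ℤ.* sign σ) ℤ.* ⟦ σ • w₂ ≟ₙ u ⟧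
    factor σ u = begin
      ⟦ (σ • w₁ ≟ₙ r₁) ×-dec (σ • w₂ ≟ₙ u) ⟧ ℤ.* sign σ
        ≡⟨ cong (ℤ._* sign σ) (⟦⟧-× (σ • w₁ ≟ₙ r₁) (σ • w₂ ≟ₙ u)) ⟩
      (⟦ σ • w₁ ≟ₙ r₁ ⟧ ℤ.* ⟦ σ • w₂ ≟ₙ u ⟧) ℤ.* sign σ
        ≡⟨ cong (λ z → (z ℤ.* ⟦ σ • w₂ ≟ₙ u ⟧) ℤ.* sign σ)
             (⟦⟧-cong (σ • w₁ ≟ₙ r₁) (matches? w₁ (lookup r₁) σ) (•⇒matches w₁ r₁ σ) (matches⇒• w₁ r₁ σ)) ⟩
      (⟦ matches? w₁ (lookup r₁) σ ⟧ ℤ.* ⟦ σ • w₂ ≟ₙ u ⟧) ℤ.* sign σ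
        ≡⟨ xy∙z≈xz∙y ⟦ matches? w₁ (lookup r₁) σ ⟧ _ _ ⟩
      (⟦ matches? w₁ (lookup r₁) σ ⟧ ℤ.* sign σ) ℤ.* ⟦ σ • w₂ ≟ₙ u ⟧ ∎

  sum-columns : ∀ {n} (w₁ w₂ : Word A n) → (∃₂ λ i j → i ≢ j × lookup w₁ i ≡ lookup w₁ j) →
    ∀ r₁ → sum (λ j → spechtMatrix _≟_ w₁ w₂ r₁ (rearrangements w₂ j)) ≡ 0ℤ
  sum-columns w₁ w₂ (i , j , i≢j , wᵢ≡wⱼ) r₁
    with σ , σw₁≡r₁ ← orbit⇒• w₁ (word∈orbit w₁ r₁) = begin
    sum (λ j → youngCharacter _≟_ w₁ w₂ (word r₁) (List.lookup (orbit w₂) j))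
      ≡⟨ listSum-lookup (youngCharacter _≟_ w₁ w₂ (word r₁)) (orbit w₂) ⟩
    listSum (youngCharacter _≟_ w₁ w₂ (word r₁)) (orbit w₂)
      ≡⟨ sum-youngCharacter w₁ w₂ (word r₁) ⟩
    signedCount w₁ (lookup (word r₁))
      -- A permutation carrying `w₁` to `r₁` takes the two positions of the repeated letter to
      -- distinct positions with equal letters.
      ≡⟨ signedCount-repeated w₁ (lookup (word r₁)) (i≢j ∘ Injection.injective (↔⇒↣ σ))
           (trans (•⇒matches w₁ _ σ σw₁≡r₁ i) (trans wᵢ≡wⱼ (sym (•⇒matches w₁ _ σ σw₁≡r₁ j)))) ⟩
    0ℤ ∎

-- Coefficient rings

module ℚ-ring = CommutativeRing ℚ.+-*-commutativeRing
module ℚ-Sum = SemiringSum ℚ-ring.semiring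
module ℝ-ring = CommutativeRing ℝ-commutativeRing
module ℂ-ring = CommutativeRing ℂ-commutativeRing

-- Addition in `ℚ` normalises, so the comparison is made among unnormalised fractions of denominator
-- 1.
/1-homo-+ : ∀ x y → (x ℤ.+ y) ℚ./ 1 ≡ x ℚ./ 1 ℚ.+ y ℚ./ 1
/1-homo-+ x y = ℚ.toℚᵘ-injective (begin
  ℚ.toℚᵘ ((x ℤ.+ y) ℚ./ 1)                       ≈⟨ ℚ.toℚᵘ-fromℚᵘ (mkℚᵘ (x ℤ.+ y) 0) ⟩
  mkℚᵘ (x ℤ.+ y) 0                               ≈⟨ *≡* (cong (ℤ._* 1ℤ) (cong₂ ℤ._+_ (ℤ.*-identityʳ x) (ℤ.*-identityʳ y))) ⟨
  mkℚᵘ x 0 ℚᵘ.+ mkℚᵘ y 0                         ≈⟨ ℚᵘ.+-cong (ℚ.toℚᵘ-fromℚᵘ (mkℚᵘ x 0)) (ℚ.toℚᵘ-fromℚᵘ (mkℚᵘ y 0)) ⟨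
  ℚ.toℚᵘ (x ℚ./ 1) ℚᵘ.+ ℚ.toℚᵘ (y ℚ./ 1)         ≈⟨ ℚ.toℚᵘ-homo-+ (x ℚ./ 1) (y ℚ./ 1) ⟨
  ℚ.toℚᵘ (x ℚ./ 1 ℚ.+ y ℚ./ 1)                   ∎)
  where open SetoidReasoning ℚᵘ.≃-setoid

/1-isMonoidHomomorphism : IsMonoidHomomorphism
  (Monoid.rawMonoid ℤ.+-0-monoid) (Monoid.rawMonoid ℚ.+-0-monoid) (ℚ._/ 1)
/1-isMonoidHomomorphism = record
  { isMagmaHomomorphism = record
    { isRelHomomorphism = record { cong = cong (ℚ._/ 1) }
    ; homo = /1-homo-+
    }
  ; ε-homo = refl
  }

ℚ→ℝ-isSemiringHomomorphism : IsSemiringHomomorphism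
  (Semiring.rawSemiring ℚ-ring.semiring) (Semiring.rawSemiring ℝ-ring.semiring) ℚ→ℝ
ℚ→ℝ-isSemiringHomomorphism = record
  { isNearSemiringHomomorphism = record
    { +-isMonoidHomomorphism = record
      { isMagmaHomomorphism = record
        { isRelHomomorphism = record { cong = λ { refl → ℝ-ring.refl } }
        ; homo = λ p q → mk≈ʳ (cauchy (ℚ→ℝ (p ℚ.+ q)))
        }
      ; ε-homo = ℝ-ring.refl
      }
    ; *-homo = λ p q → mk≈ʳ (cauchy (ℚ→ℝ (p ℚ.* q)))
    }
  ; 1#-homo = ℝ-ring.refl
  }

module _ (R : CommutativeRing c ℓ) where
  open CommutativeRing R
  open AdjoinI R using (adjoinI)
  open RingProperties ring using (-0#≈0#)

  embed-isSemiringHomomorphism : IsSemiringHomomorphism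
    (Semiring.rawSemiring semiring) (Semiring.rawSemiring (CommutativeRing.semiring adjoinI)) (_, 0#)
  embed-isSemiringHomomorphism = record
    { isNearSemiringHomomorphism = record
      { +-isMonoidHomomorphism = record
        { isMagmaHomomorphism = record
          { isRelHomomorphism = record { cong = λ x≈y → x≈y , Eq.refl }
          ; homo = λ _ _ → Eq.refl , Eq.sym (+-identityˡ 0#)
          }
        ; ε-homo = Eq.refl , Eq.refl
        }
      ; *-homo = λ x y → Eq.sym (real x y)
               , Eq.sym (Eq.trans (+-cong (zeroʳ x) (zeroˡ y)) (+-identityˡ 0#))
      }
    ; 1#-homo = Eq.refl , Eq.refl
    }
    where
    module Eq = Setoid setoid
    real : ∀ x y → x * y - 0# * 0# ≈ x * y
    real x y = Eq.trans (+-congˡ (Eq.trans (-‿cong (zeroˡ 0#)) -0#≈0#)) (+-identityʳ _)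

ℚ→ℂ-isSemiringHomomorphism : IsSemiringHomomorphism
  (Semiring.rawSemiring ℚ-ring.semiring) (Semiring.rawSemiring ℂ-ring.semiring) (λ q → ℚ→ℝ q , 0ʳ)
ℚ→ℂ-isSemiringHomomorphism = Composition.isSemiringHomomorphism ℂ-ring.trans
  ℚ→ℝ-isSemiringHomomorphism (embed-isSemiringHomomorphism ℝ-commutativeRing)

-- A finite search over the enumerated rows, possible because equality with zero is decidable in
-- `ℚ`.
ℚ-pivot? : {I : Set i} {m : ℕ} (enum : Fin m → I) → (∀ x → ∃[ j ] enum j ≡ x) →
  (v : I → ℚ) → (∀ x → v x ≡ 0ℚ) ⊎ ∃₂ λ x y → v x ℚ.* y ≡ 1ℚ
ℚ-pivot? {m = m} enum onto v with Fin.all? (λ j → v (enum j) ℚ.≟ 0ℚ)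
... | yes v≡0 = inj₁ λ x → let j , eq = onto x in subst (λ x → v x ≡ 0ℚ) eq (v≡0 j)
... | no ¬v≡0 with j , vⱼ≢0 ← Fin.¬∀⟶∃¬ m _ (λ j → v (enum j) ℚ.≟ 0ℚ) ¬v≡0 =
  inj₂ (enum j , (ℚ.1/ v (enum j)) , ℚ.*-inverseʳ (v (enum j)))
  where instance nonZero = ℚ.≢-nonZero vⱼ≢0

sum-ones-positive : ∀ m → 0ℚ ℚ.< ℚ-Sum.sum {suc m} (λ _ → 1ℚ)
sum-ones-positive zero    = ℚ.positive⁻¹ 1ℚ
sum-ones-positive (suc m) = ℚ.+-mono-< (ℚ.positive⁻¹ 1ℚ) (sum-ones-positive m)

sum-ones-invertible : ∀ {m} → Fin m → ∃[ q ] ℚ-Sum.sum {m} (λ _ → 1ℚ) ℚ.* q ≡ 1ℚ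
sum-ones-invertible {suc m} _ = ℚ.1/ s , ℚ.*-inverseʳ s
  where
  s = ℚ-Sum.sum {suc m} (λ _ → 1ℚ)
  instance nonZero = ℚ.>-nonZero (sum-ones-positive m)

theorem5p4 : ∀ {a} {A : Set a} (_≟_ : DecidableEquality A)
    (n : ℕ) → 1 ≤ n →
    (Λ : Partition n) → parts Λ ≢ replicate n 1 →
    (w₁ w₂ : Word A n) → Complementary w₁ w₂ → CorrespondsTo _≟_ w₁ w₂ Λ →
    ∃[ d ] (HasSpechtPolytopeDimension _≟_ w₁ w₂ d × HasSpechtModuleDimension _≟_ w₁ w₂ d)
theorem5p4 {A = A} _≟_ n _ Λ ≢ones w₁ w₂ _ (mults , _) =
    rank echelonℚ
  -- The base point is the origin, so the translated hull is the span itself. Translation by `0ᵥ` is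
  -- trivial only up to `≈ʳ`, whence the shifted variants below.
  , (0ᵥ , polytope-hull⁺ zero-vector∈ , Eℝ.Echelon.hasDimension echelonℝ polytope-hull⁻-shifted polytope-hull⁺-shifted)
  , Eℂ.Echelon.hasDimension echelonℂ module⁻ module⁺
  where
  I = Rearrangement w₁
  module Rows = Orbit _≟_ w₁
  module Columns = Orbit _≟_ w₂
  module Eℚ = Elimination ℚ.+-*-commutativeRing I
  module Eℝ = Elimination ℝ-commutativeRing I
  module Eℂ = Elimination ℂ-commutativeRing I
  module Vℂ = ComplexSpace I
  open RealSpace I
  open Eℚ.Echelon using (rank)
  open SemiringSum ℝ-ring.semiring using (sum; sum-cong-≋)
  open SumHomomorphism ℚ.+-0-monoid ℝ-ring.+-monoid
    (IsSemiringHomomorphism.+-isMonoidHomomorphism ℚ→ℝ-isSemiringHomomorphism)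
    using () renaming (sum-homo to ℚ→ℝ-sum)
  open SumHomomorphism ℤ.+-0-monoid ℚ.+-0-monoid /1-isMonoidHomomorphism
    using () renaming (sum-homo to ℤ→ℚ-sum)
  open SetoidReasoning ℝ-ring.setoid

  entry : Fin Columns.size → I → ℤ
  entry j r₁ = spechtMatrix _≟_ w₁ w₂ r₁ (Columns.rearrangements j)

  columnℝ : Fin Columns.size → V
  columnℝ j r₁ = ℤ→ℝ (entry j r₁)

  columnℂ : Fin Columns.size → Vℂ.V
  columnℂ j r₁ = ℤ→ℂ (entry j r₁)

  echelonℚ : Eℚ.Echelon (λ j r₁ → entry j r₁ ℚ./ 1)
  echelonℚ = Eℚ.echelon (ℚ-pivot? Rows.rearrangements Rows.rearrangements-onto) _

  -- The real columns are definitionally the images of the rational ones, so the echelon form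
  -- transports as it stands.
  echelonℝ : Eℝ.Echelon columnℝ
  echelonℝ = Transport.mapEchelon ℚ.+-*-commutativeRing ℝ-commutativeRing I ℚ→ℝ-isSemiringHomomorphism echelonℚ

  echelonℂ : Eℂ.Echelon columnℂ
  echelonℂ = Transport.mapEchelon ℚ.+-*-commutativeRing ℂ-commutativeRing I ℚ→ℂ-isSemiringHomomorphism echelonℚ

  module⁺ : ∀ v → v Eℂ.∈⟨ columnℂ ⟩ → SpechtModule _≟_ w₁ w₂ v
  module⁺ v (α , v≈) =
    _ , columnℂ , α , (λ j → Columns.rearrangements j , λ _ → ℂ-ring.refl) , v≈

  module⁻ : ∀ v → SpechtModule _≟_ w₁ w₂ v → v Eℂ.∈⟨ columnℂ ⟩
  module⁻ v (_ , us , α , us∈ , v≈) = Eℂ.∈⟨⟩-trans us columnℂ (α , v≈) column∈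
    where
    column∈ : ∀ j → us j Eℂ.∈⟨ columnℂ ⟩
    column∈ j with r₂ , uⱼ≈ ← us∈ j with k , refl ← Columns.rearrangements-onto r₂ =
      let β , col≈ = Eℂ.generator∈ columnℂ k in β , λ x → ℂ-ring.trans (uⱼ≈ x) (col≈ x)

  Hull : V → Set _
  Hull = AffineHull (SpechtPolytope _≟_ w₁ w₂)

  columns-sum-to-zero : ∀ r₁ → sum (λ j → columnℝ j r₁) ≈ʳ 0ʳ
  columns-sum-to-zero r₁ = begin
    sum (λ j → columnℝ j r₁)
      ≈⟨ ℚ→ℝ-sum (λ j → entry j r₁ ℚ./ 1) ⟨
    ℚ→ℝ (ℚ-Sum.sum (λ j → entry j r₁ ℚ./ 1))
      ≡⟨ cong ℚ→ℝ (ℤ→ℚ-sum (λ j → entry j r₁)) ⟨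
    ℤ→ℝ (ℤ-Sum.sum (λ j → entry j r₁))
      ≡⟨ cong ℤ→ℝ (sum-columns _≟_ w₁ w₂ (repeated-letter _≟_ Λ ≢ones w₁ mults) r₁) ⟩
    0ʳ ∎

  column∈polytope : ∀ j → SpechtPolytope _≟_ w₁ w₂ (columnℝ j)
  column∈polytope j =
      1 , (λ _ → columnℝ j) , (λ _ → 1ʳ)
    , (λ _ → Columns.rearrangements j , λ _ → ℝ-ring.refl)
    -- Order on `ℝ` allows an error `ε`, so the bound to prove is `0 ≤ 1 + ε`.
    , (λ _ ε 0<ε → 0 , λ _ _ → ℚ.+-mono-≤ (ℚ.nonNegative⁻¹ 1ℚ) (ℚ.<⇒≤ 0<ε))
    , ℝ-ring.+-identityʳ 1ʳ
    , λ x → ℝ-ring.sym (ℝ-ring.trans (ℝ-ring.+-identityʳ _) (ℝ-ring.*-identityˡ _))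

  polytope-hull⁺ : ∀ {v} → v Eℝ.∈⟨ columnℝ ⟩ → Hull v
  -- `q` is the reciprocal of the number of columns, obtained over `ℚ` and then mapped to `ℝ`.
  polytope-hull⁺ v∈ with q , mq≡1 ← sum-ones-invertible Columns.position =
    let β , β-sum , v≈ = Eℝ.affine-coefficients columnℝ columns-sum-to-zero (ℚ→ℝ q) mq≈1 v∈
    in _ , columnℝ , β , column∈polytope , β-sum , v≈
    where
    mq≈1 : sum {Columns.size} (λ _ → 1ʳ) *ʳ ℚ→ℝ q ≈ʳ 1ʳ
    mq≈1 = begin
      sum {Columns.size} (λ _ → 1ʳ) *ʳ ℚ→ℝ q
        ≈⟨ ℝ-ring.*-congʳ (ℚ→ℝ-sum {Columns.size} (λ _ → 1ℚ)) ⟨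
      ℚ→ℝ (ℚ-Sum.sum {Columns.size} (λ _ → 1ℚ)) *ʳ ℚ→ℝ q
        ≈⟨ IsSemiringHomomorphism.*-homo ℚ→ℝ-isSemiringHomomorphism (ℚ-Sum.sum {Columns.size} (λ _ → 1ℚ)) q ⟨
      ℚ→ℝ (ℚ-Sum.sum {Columns.size} (λ _ → 1ℚ) ℚ.* q)
        ≡⟨ cong ℚ→ℝ mq≡1 ⟩
      1ʳ ∎

  polytope⁻ : ∀ v → SpechtPolytope _≟_ w₁ w₂ v → v Eℝ.∈⟨ columnℝ ⟩
  polytope⁻ v (_ , us , α , us∈ , _ , _ , v≈) = Eℝ.∈⟨⟩-trans us columnℝ (α , v≈) column∈
    where
    column∈ : ∀ j → us j Eℝ.∈⟨ columnℝ ⟩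
    column∈ j with r₂ , uⱼ≈ ← us∈ j with k , refl ← Columns.rearrangements-onto r₂ =
      let β , col≈ = Eℝ.generator∈ columnℝ k in β , λ x → ℝ-ring.trans (uⱼ≈ x) (col≈ x)

  polytope-hull⁻ : ∀ {v} → Hull v → v Eℝ.∈⟨ columnℝ ⟩
  polytope-hull⁻ (_ , us , α , us∈ , _ , v≈) =
    Eℝ.∈⟨⟩-trans us columnℝ (α , v≈) (λ j → polytope⁻ (us j) (us∈ j))

  zero-vector∈ : 0ᵥ Eℝ.∈⟨ columnℝ ⟩
  zero-vector∈ = (λ _ → 0ʳ) , λ x → ℝ-ring.sym (Eℝ.sum-zero {Columns.size} _ (λ j → ℝ-ring.zeroˡ _))

  polytope-hull⁺-shifted : ∀ v → v Eℝ.∈⟨ columnℝ ⟩ → Hull (0ᵥ +ᵥ v)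
  polytope-hull⁺-shifted v (α , v≈) = polytope-hull⁺ (α , λ x → ℝ-ring.trans (ℝ-ring.+-identityˡ _) (v≈ x))

  polytope-hull⁻-shifted : ∀ v → Hull (0ᵥ +ᵥ v) → v Eℝ.∈⟨ columnℝ ⟩
  polytope-hull⁻-shifted v h =
    let α , v≈ = polytope-hull⁻ h in α , λ x → ℝ-ring.trans (ℝ-ring.sym (ℝ-ring.+-identityˡ _)) (v≈ x)
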